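{- For every integer $k>1$, let $h_k=\frac{3}{2}k^2-\frac{3}{2}k$ and $n_k=\frac{9}{2}k^2+\frac{3}{2}k-2$. Then $g_{\triangle}(h_k)=n_k$.
   Context: A polyiamond is a planar shape formed as a finite union of closed congruent equilateral triangles (tiles) of the regular triangular lattice, glued along edges, such that any two tiles meeting do so along an entire edge and the interior of the union is connected. Polyiamonds are considered up to isometry. For a polyiamond $A$, $|A|$ is its number of tiles and $h(A)$ is its number of holes, i.e. the number of bounded connected components of $\mathbb{R}^2\setminus A$. For $h\ge 1$, $g_{\triangle}(h)$ is the minimum of $|A|$ over all polyiamonds $A$ with $h(A)=h$. -}

module Defs where

open import Data.Nat using (ℕ; _+_; _*_; _∸_; _≤_)
open import Data.Nat.DivMod using (_/_)
open import Data.Integer using (ℤ; 1ℤ) renaming (_-_ to _-ℤ_)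
open import Data.Bool using (Bool; true; false)
open import Data.Fin using (Fin)
open import Data.List using (List; length; []; _∷_)
open import Data.List.Membership.Propositional using (_∈_; _∉_)
open import Data.List.Relation.Unary.Unique.Propositional using (Unique)
open import Data.Product using (Σ; ∃; _×_; _,_)
open import Data.Sum using (_⊎_)
open import Data.Empty using (⊥)
open import Relation.Binary.PropositionalEquality using (_≡_)
open import Relation.Nullary using (¬_)

-- A tile of the regular triangular lattice, in lattice coordinates
-- (basis vectors e₁ = (1,0), e₂ = (1/2, √3/2)).
--   (x , y , true)  : "up"   triangle with vertices (x,y), (x+1,y), (x,y+1)
--   (x , y , false) : "down" triangle with vertices (x+1,y), (x,y+1), (x+1,y+1)
Tile : Set
Tile = ℤ × ℤ × Bool

UpAdj : Tile → Tile → Set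
UpAdj (x , y , true) t =
  (t ≡ (x , y , false)) ⊎ (t ≡ ((x -ℤ 1ℤ) , y , false)) ⊎ (t ≡ (x , (y -ℤ 1ℤ) , false))
UpAdj (x , y , false) t = ⊥

Adj : Tile → Tile → Set
Adj t u = UpAdj t u ⊎ UpAdj u t

data Path (P : Tile → Set) : Tile → Tile → Set where
  here : ∀ {t} → P t → Path P t t
  step : ∀ {t u v} → P t → Adj t u → Path P u v → Path P t v

-- A polyiamond: a finite nonempty set of tiles (duplicate-free list) whose
-- union has connected interior, i.e. is connected via shared edges.
IsPolyiamond : List Tile → Set
IsPolyiamond A =
  Unique A × (¬ (A ≡ [])) × (∀ t u → t ∈ A → u ∈ A → Path (_∈ A) t u)

-- Tiles not in A (their open interiors, together with open edges between
-- them, make up the complement of A).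
Out : List Tile → Tile → Set
Out A t = t ∉ A

BoundedComp : List Tile → Tile → Set
BoundedComp A t = Σ (List Tile) λ L → ∀ u → Path (Out A) t u → u ∈ L

HasHoles : List Tile → ℕ → Set
HasHoles A h =
  Σ (Fin h → Tile) λ f →
    (∀ i → Out A (f i) × BoundedComp A (f i)) ×
    (∀ i j → Path (Out A) (f i) (f j) → i ≡ j) ×
    (∀ t → Out A t → BoundedComp A t → ∃ λ i → Path (Out A) t (f i))

size : List Tile → ℕ
size = length

gTriEq : ℕ → ℕ → Set
gTriEq h n =
  (Σ (List Tile) λ A → IsPolyiamond A × HasHoles A h × size A ≡ n) ×
  (∀ A → IsPolyiamond A → HasHoles A h → n ≤ size A)

hk : ℕ → ℕ
hk k = (3 * k * k ∸ 3 * k) / 2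

nk : ℕ → ℕ
nk k = (9 * k * k + 3 * k ∸ 4) / 2

{-# OPTIONS --safe #-}

-- Lower bound. Let A have n tiles and h holes and meet w strips, summed over the
-- three directions. Count pairs (tile, one of 6 directions of travel along a strip).
-- Connectedness gives at least n - 1 shared edges, each seen 4 times. Walking from a hole
-- along each of its 3 strips, both ways, hits A in 6 sides, and the two ends of
-- each strip met by A are sides facing the unbounded component. All of these are
-- distinct, so 4(n - 1) + 6h + 2w ≤ 6n, that is 3h + w ≤ n + 2. Moreover A and one
-- tile of every hole lie in a hexagon of total strip width w, which has at most
-- w²/6 tiles, so 6(n + h) ≤ w². For h = h_k the two inequalities force n ≥ n_k.
--
-- Construction. The hexagon with sides alternately k + 1 and k - 1 has 6k² - 2
-- tiles and decomposes into concentric rings. The edges between consecutive rings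
-- form a cycle of even length; removing the outer tile at every second of these
-- edges creates isolated one-tile holes, 3(r - 1) of them in ring r, and leaves a
-- connected set.

module Submission where

open import Defs
open import Data.Bool using (Bool; true; false; not)
import Data.Bool.Properties as Bool
open import Data.Empty using (⊥; ⊥-elim)
open import Data.Fin as Fin using (Fin; toℕ)
import Data.Fin.Properties as Fin
open import Data.Integer using (ℤ; +_; -[1+_]; 0ℤ; 1ℤ; -1ℤ; _+_; _-_; _*_; -_; ∣_∣; _≤_; +≤+; -≤+)
import Data.Integer.Properties as ℤ
open import Data.Integer.Tactic.RingSolver using (solve; solve-∀)
open import Data.List using (List; []; _∷_; _++_; allFin; applyUpTo; cartesianProduct; concatMap; filter; length; lookup; map; tabulate; upTo)
open import Data.List.Membership.Propositional using (_∈_; _∉_; find)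
open import Data.List.Membership.Propositional.Properties
open import Data.List.Properties using (length-++; length-applyUpTo; length-map; length-tabulate; length-upTo)
open import Data.List.Relation.Unary.All using (All)
import Data.List.Relation.Unary.All as All
import Data.List.Relation.Unary.All.Properties as All
import Data.List.Relation.Unary.AllPairs as AllPairs
open import Data.List.Relation.Unary.Any using (here; there; index)
import Data.List.Relation.Unary.Any.Properties as Any
open import Data.List.Relation.Unary.Unique.Propositional using (Unique)
import Data.List.Relation.Unary.Unique.Propositional.Properties as Unique
open import Data.Nat as ℕ using (ℕ; zero; suc; z≤n; s≤s)
open import Data.Nat.DivMod using (_/_; m*n/n≡m)
open import Data.Nat.ListAction using (sum)
import Data.Nat.Properties as ℕ
open import Data.Nat.Tactic.RingSolver using () renaming (solve-∀ to solveℕ-∀)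
open import Data.Product using (Σ; ∃; _×_; _,_; proj₁; proj₂)
open import Data.Product.Properties using (≡-dec)
open import Data.Sum as Sum using (_⊎_; inj₁; inj₂)
open import Data.Unit using (tt)
open import Function using (_∘_)
open import Relation.Binary using (DecidableEquality)
open import Relation.Binary.PropositionalEquality
open import Relation.Nullary using (¬_; Dec; yes; no; contradiction)
open import Relation.Nullary.Decidable using (_×-dec_; ¬?; map′; toWitness)
open import Algebra.Properties.AbelianGroup ℤ.+-0-abelianGroup using (∙-cancelˡ; ⁻¹-injective)

-- With p = n + 2 - 3h the two inequalities read w ≤ p and 6(n + h) ≤ w², and for h = h_k they give
-- (p - 3)² ≥ (6k - 3)² - 12. The 12 is harmless as long as 12k > 19, which is where k > 1 enters:
-- then p - 3 > 6k - 4, so p ≥ 6k. The same slack admits 6k² - 2 tiles in place of the 6k² of the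
-- regular hexagon with w = 6k. The alternating hexagon has a tile at its centre and a threefold
-- symmetry about it, so every argument on the construction is made in one of three rotated copies.
-- Equality in the first inequality leaves no room for a cycle of adjacent tiles, so the holes must
-- break every such cycle without disconnecting the rest. Following strips takes the place of
-- boundary curves and Euler's formula: a walk starting in a bounded component must run into A
-- whatever the shape of the hole, and the sides found are told apart by direction, strip and
-- component alone.

module _ {A : Set} where
  -- The pigeonhole principle behind every counting inequality below: sides are counted inside the
  -- list of all sides of `A`, tiles inside a parallelogram.
  Unique-⊆⇒length≤ : {xs ys : List A} → Unique xs → (∀ {x} → x ∈ xs → x ∈ ys) →
                     length xs ℕ.≤ length ys
  Unique-⊆⇒length≤ {[]} _ _ = z≤n
  Unique-⊆⇒length≤ {x ∷ xs} (x∉xs AllPairs.∷ u) sub with ∈-∃++ (sub (here refl))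
  ... | as , bs , refl = subst (suc (length xs) ℕ.≤_) eq (s≤s (Unique-⊆⇒length≤ u sub′))
    where
    sub′ : ∀ {y} → y ∈ xs → y ∈ as ++ bs
    sub′ y∈ with ∈-++⁻ as (sub (there y∈))
    ... | inj₁ p = ∈-++⁺ˡ p
    ... | inj₂ (here refl) = contradiction refl (All.lookup x∉xs y∈)
    ... | inj₂ (there p) = ∈-++⁺ʳ as p
    eq : suc (length (as ++ bs)) ≡ length (as ++ x ∷ bs)
    eq rewrite length-++ as {bs} | length-++ as {x ∷ bs} = sym (ℕ.+-suc (length as) (length bs))

-- Linear arithmetic over ℤ: an inequality is certified by writing the
-- difference of its sides as a sum of nonnegative differences.
certify : ∀ {a b d} → 0ℤ ≤ d → b - a ≡ d → a ≤ b
certify 0≤d eq = ℤ.0≤i-j⇒j≤i (subst (0ℤ ≤_) (sym eq) 0≤d)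

gap : ∀ {a b} → a ≤ b → 0ℤ ≤ b - a
gap = ℤ.i≤j⇒0≤j-i

infixl 6 _⊕_
_⊕_ : ∀ {a b} → 0ℤ ≤ a → 0ℤ ≤ b → 0ℤ ≤ a + b
_⊕_ = ℤ.+-mono-≤

absurd-by : ∀ {d n} {W : Set} → 0ℤ ≤ d → d ≡ -[1+ n ] → W
absurd-by p refl with () ← p

-- Tiles, strips and walks

data Axis : Set where
  X Y Z : Axis

_≟ᵃ_ : DecidableEquality Axis
X ≟ᵃ X = yes refl
X ≟ᵃ Y = no λ ()
X ≟ᵃ Z = no λ ()
Y ≟ᵃ X = no λ ()
Y ≟ᵃ Y = yes refl
Y ≟ᵃ Z = no λ ()
Z ≟ᵃ X = no λ ()
Z ≟ᵃ Y = no λ ()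
Z ≟ᵃ Z = yes refl

σ : Axis → Axis
σ X = Y
σ Y = Z
σ Z = X

σ³ : ∀ a → σ (σ (σ a)) ≡ a
σ³ X = refl
σ³ Y = refl
σ³ Z = refl

-- Reduces a claim about an arbitrary axis to the three positions relative to a chosen one, which is
-- how the threefold symmetry is used.
orbit : ∀ a b → (b ≡ a) ⊎ (b ≡ σ a) ⊎ (b ≡ σ (σ a))
orbit X X = inj₁ refl
orbit X Y = inj₂ (inj₁ refl)
orbit X Z = inj₂ (inj₂ refl)
orbit Y X = inj₂ (inj₂ refl)
orbit Y Y = inj₁ refl
orbit Y Z = inj₂ (inj₁ refl)
orbit Z X = inj₂ (inj₁ refl)
orbit Z Y = inj₂ (inj₂ refl)
orbit Z Z = inj₁ refl

_≟ᵗ_ : DecidableEquality Tile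
_≟ᵗ_ = ≡-dec ℤ._≟_ (≡-dec ℤ._≟_ Bool._≟_)

open import Data.List.Membership.DecPropositional _≟ᵗ_ using (_∈?_)

up : Tile → Bool
up (_ , _ , b) = b

-- The indices of the three strips containing a tile. They sum to 0 on up
-- triangles and to -1 on down triangles, which makes them cyclically symmetric.
c : Axis → Tile → ℤ
c X (x , _ , _) = x
c Y (_ , y , _) = y
c Z (x , y , true) = - (x + y)
c Z (x , y , false) = - (1ℤ + x + y)

total : Bool → ℤ
total true = 0ℤ
total false = -1ℤ

c-sum : ∀ a t → c a t + c (σ a) t + c (σ (σ a)) t ≡ total (up t)
c-sum X (x , y , true) = lem x y
  where lem : ∀ x y → x + y + - (x + y) ≡ 0ℤ
        lem = solve-∀
c-sum X (x , y , false) = lem x y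
  where lem : ∀ x y → x + y + - (1ℤ + x + y) ≡ -1ℤ
        lem = solve-∀
c-sum Y (x , y , true) = lem x y
  where lem : ∀ x y → y + - (x + y) + x ≡ 0ℤ
        lem = solve-∀
c-sum Y (x , y , false) = lem x y
  where lem : ∀ x y → y + - (1ℤ + x + y) + x ≡ -1ℤ
        lem = solve-∀
c-sum Z (x , y , true) = lem x y
  where lem : ∀ x y → - (x + y) + x + y ≡ 0ℤ
        lem = solve-∀
c-sum Z (x , y , false) = lem x y
  where lem : ∀ x y → - (1ℤ + x + y) + x + y ≡ -1ℤ
        lem = solve-∀

-- The edge crossed is the one parallel to the strips of the given axis, so only that index changes.
-- One involution per axis replaces the case distinctions in `Adj`.
nb : Axis → Tile → Tile
nb X (x , y , true) = x - 1ℤ , y , false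
nb Y (x , y , true) = x , y - 1ℤ , false
nb Z (x , y , true) = x , y , false
nb X (x , y , false) = x + 1ℤ , y , true
nb Y (x , y , false) = x , y + 1ℤ , true
nb Z (x , y , false) = x , y , true

-1+1 : ∀ x → x - 1ℤ + 1ℤ ≡ x
-1+1 = solve-∀

+1-1 : ∀ x → x + 1ℤ - 1ℤ ≡ x
+1-1 = solve-∀

nb-involutive : ∀ a t → nb a (nb a t) ≡ t
nb-involutive X (x , y , true) = cong (_, y , true) (-1+1 x)
nb-involutive Y (x , y , true) = cong (λ y → x , y , true) (-1+1 y)
nb-involutive Z (x , y , true) = refl
nb-involutive X (x , y , false) = cong (_, y , false) (+1-1 x)
nb-involutive Y (x , y , false) = cong (λ y → x , y , false) (+1-1 y)
nb-involutive Z (x , y , false) = refl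

up-nb : ∀ a t → up (nb a t) ≡ not (up t)
up-nb X (x , y , true) = refl
up-nb Y (x , y , true) = refl
up-nb Z (x , y , true) = refl
up-nb X (x , y , false) = refl
up-nb Y (x , y , false) = refl
up-nb Z (x , y , false) = refl

sgn : Bool → ℤ
sgn true = -1ℤ
sgn false = 1ℤ

c-nb : ∀ a t → c a (nb a t) ≡ c a t + sgn (up t)
c-nb X (x , y , true) = refl
c-nb Y (x , y , true) = refl
c-nb Z (x , y , true) = lem x y
  where lem : ∀ x y → - (1ℤ + x + y) ≡ - (x + y) + -1ℤ
        lem = solve-∀
c-nb X (x , y , false) = refl
c-nb Y (x , y , false) = refl
c-nb Z (x , y , false) = lem x y
  where lem : ∀ x y → - (x + y) ≡ - (1ℤ + x + y) + 1ℤ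
        lem = solve-∀

c-nb-σ : ∀ a t → c (σ a) (nb a t) ≡ c (σ a) t
c-nb-σ X (x , y , true) = refl
c-nb-σ Y (x , y , true) = lem x y
  where lem : ∀ x y → - (1ℤ + x + (y - 1ℤ)) ≡ - (x + y)
        lem = solve-∀
c-nb-σ Z (x , y , true) = refl
c-nb-σ X (x , y , false) = refl
c-nb-σ Y (x , y , false) = lem x y
  where lem : ∀ x y → - (x + (y + 1ℤ)) ≡ - (1ℤ + x + y)
        lem = solve-∀
c-nb-σ Z (x , y , false) = refl

c-nb-σσ : ∀ a t → c (σ (σ a)) (nb a t) ≡ c (σ (σ a)) t
c-nb-σσ X (x , y , true) = lem x y
  where lem : ∀ x y → - (1ℤ + (x - 1ℤ) + y) ≡ - (x + y)
        lem = solve-∀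
c-nb-σσ Y (x , y , true) = refl
c-nb-σσ Z (x , y , true) = refl
c-nb-σσ X (x , y , false) = lem x y
  where lem : ∀ x y → - (x + 1ℤ + y) ≡ - (1ℤ + x + y)
        lem = solve-∀
c-nb-σσ Y (x , y , false) = refl
c-nb-σσ Z (x , y , false) = refl

Adj-sym : ∀ {t u} → Adj t u → Adj u t
Adj-sym (inj₁ p) = inj₂ p
Adj-sym (inj₂ p) = inj₁ p

nb-Adj : ∀ a t → Adj t (nb a t)
nb-Adj X (x , y , true) = inj₁ (inj₂ (inj₁ refl))
nb-Adj Y (x , y , true) = inj₁ (inj₂ (inj₂ refl))
nb-Adj Z (x , y , true) = inj₁ (inj₁ refl)
nb-Adj X t@(x , y , false) = inj₂ (inj₂ (inj₁ (sym (nb-involutive X t))))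
nb-Adj Y t@(x , y , false) = inj₂ (inj₂ (inj₂ (sym (nb-involutive Y t))))
nb-Adj Z (x , y , false) = inj₂ (inj₁ refl)

UpAdj⇒nb : ∀ t u → UpAdj t u → ∃ λ a → u ≡ nb a t
UpAdj⇒nb (x , y , true) u (inj₁ p) = Z , p
UpAdj⇒nb (x , y , true) u (inj₂ (inj₁ p)) = X , p
UpAdj⇒nb (x , y , true) u (inj₂ (inj₂ p)) = Y , p

Adj⇒nb : ∀ {t u} → Adj t u → ∃ λ a → u ≡ nb a t
Adj⇒nb {t} {u} (inj₁ p) = UpAdj⇒nb t u p
Adj⇒nb {t} {u} (inj₂ p) with UpAdj⇒nb u t p
... | a , refl = a , sym (nb-involutive a u)

module _ {P : Tile → Set} where
  Path-start : ∀ {t u} → Path P t u → P t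
  Path-start (here p) = p
  Path-start (step p _ _) = p

  Path-end : ∀ {t u} → Path P t u → P u
  Path-end (here p) = p
  Path-end (step _ _ q) = Path-end q

  Path-trans : ∀ {t u v} → Path P t u → Path P u v → Path P t v
  Path-trans (here _) q = q
  Path-trans (step p a r) q = step p a (Path-trans r q)

  Path-sym : ∀ {t u} → Path P t u → Path P u t
  Path-sym (here p) = here p
  Path-sym (step p a r) =
    Path-trans (Path-sym r) (step (Path-start r) (Adj-sym a) (here p))

  Path-nb : ∀ a {t} → P t → P (nb a t) → Path P t (nb a t)
  Path-nb a {t} p q = step p (nb-Adj a t) (here q)

-- (a , s) walks inside a strip of constant index c a; s is the sense of travel.
Dir : Set
Dir = Axis × Bool

_≟ᵈ_ : DecidableEquality Dir
_≟ᵈ_ = ≡-dec _≟ᵃ_ Bool._≟_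

open import Data.List.Relation.Unary.Unique.DecPropositional _≟ᵈ_ using (unique?)

opp : Dir → Dir
opp (a , s) = a , not s

-- Inside a strip the walk crosses edges of the other two axes alternately, and the sense decides
-- which of them an up tile uses. Reversing both sense and orientation gives the same edge, so a
-- step can be undone by the opposite direction.
turn : Dir → Bool → Axis
turn (a , true) true = σ a
turn (a , true) false = σ (σ a)
turn (a , false) true = σ (σ a)
turn (a , false) false = σ a

next : Dir → Tile → Tile
next d t = nb (turn d (up t)) t

turn-opp : ∀ d b → turn (opp d) (not b) ≡ turn d b
turn-opp (a , true) true = refl
turn-opp (a , true) false = refl
turn-opp (a , false) true = refl
turn-opp (a , false) false = refl

next-opp : ∀ d t → next (opp d) (next d t) ≡ t
next-opp d t
  rewrite up-nb (turn d (up t)) t | turn-opp d (up t) = nb-involutive (turn d (up t)) t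

opp-involutive : ∀ d → opp (opp d) ≡ d
opp-involutive (a , true) = refl
opp-involutive (a , false) = refl

c-nb-σ′ : ∀ a t → c a (nb (σ a) t) ≡ c a t
c-nb-σ′ a t = subst (λ b → c b (nb (σ a) t) ≡ c b t) (σ³ a) (c-nb-σσ (σ a) t)

c-nb-σσ′ : ∀ a t → c a (nb (σ (σ a)) t) ≡ c a t
c-nb-σσ′ a t = subst (λ b → c b (nb (σ (σ a)) t) ≡ c b t) (σ³ a) (c-nb-σ (σ (σ a)) t)

c-next : ∀ a s t → c a (next (a , s) t) ≡ c a t
c-next a true t with up t
... | true = c-nb-σ′ a t
... | false = c-nb-σσ′ a t
c-next a false t with up t
... | true = c-nb-σσ′ a t
... | false = c-nb-σ′ a t

-- A coordinate along the strip. Crossing lowers an index when leaving an up tile and raises one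
-- when leaving a down tile; with this choice of signs both raise the difference by one.
pos : Dir → Tile → ℤ
pos (a , true) t = c (σ (σ a)) t - c (σ a) t
pos (a , false) t = c (σ a) t - c (σ (σ a)) t

pos-fst : ∀ {p p′ q q′} → p′ ≡ p + 1ℤ → q′ ≡ q → p′ - q′ ≡ p - q + 1ℤ
pos-fst {p} {q = q} refl refl = lem p q
  where lem : ∀ p q → p + 1ℤ - q ≡ p - q + 1ℤ
        lem = solve-∀

pos-snd : ∀ {p p′ q q′} → p′ ≡ p → q′ ≡ q + -1ℤ → p′ - q′ ≡ p - q + 1ℤ
pos-snd {p} {q = q} refl refl = lem p q
  where lem : ∀ p q → p - (q + -1ℤ) ≡ p - q + 1ℤ
        lem = solve-∀

pos-next : ∀ d t → pos d (next d t) ≡ pos d t + 1ℤ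
pos-next (a , true) t@(_ , _ , true) = pos-snd (c-nb-σ (σ a) t) (c-nb (σ a) t)
pos-next (a , true) t@(_ , _ , false) = pos-fst {c (σ (σ a)) t} (c-nb (σ (σ a)) t) (c-nb-σ′ (σ a) t)
pos-next (a , false) t@(_ , _ , true) = pos-snd (c-nb-σ′ (σ a) t) (c-nb (σ (σ a)) t)
pos-next (a , false) t@(_ , _ , false) = pos-fst {c (σ a) t} (c-nb (σ a) t) (c-nb-σ (σ a) t)

iter : Dir → ℕ → Tile → Tile
iter d zero t = t
iter d (suc n) t = next d (iter d n t)

c-iter : ∀ a s n t → c a (iter (a , s) n t) ≡ c a t
c-iter a s zero t = refl
c-iter a s (suc n) t = trans (c-next a s (iter (a , s) n t)) (c-iter a s n t)

pos-iter : ∀ d n t → pos d (iter d n t) ≡ pos d t + + n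
pos-iter d zero t = sym (ℤ.+-identityʳ _)
pos-iter d (suc n) t = trans (pos-next d (iter d n t))
  (trans (cong (_+ 1ℤ) (pos-iter d n t)) (lem (pos d t) (+ n)))
  where lem : ∀ p m → p + m + 1ℤ ≡ p + (1ℤ + m)
        lem = solve-∀

module _ {A B : Set} where
  concatMap-unique : (key : B → A) (f : A → List B) → (∀ x → Unique (f x)) →
                     (∀ x {y} → y ∈ f x → key y ≡ x) →
                     {xs : List A} → Unique xs → Unique (concatMap f xs)
  concatMap-unique key f uf kf AllPairs.[] = AllPairs.[]
  concatMap-unique key f uf kf {x ∷ xs} (x∉xs AllPairs.∷ u) =
    Unique.++⁺ (uf x) (concatMap-unique key f uf kf u) disjoint
    where
    disjoint : ∀ {y} → y ∈ f x × y ∈ concatMap f xs → ⊥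
    disjoint (p , q) with ∈-concatMap⁻ f {xs = xs} q
    ... | r with find r
    ... | x′ , x′∈ , y∈ =
      contradiction (trans (sym (kf x p)) (kf x′ y∈)) (All.lookup x∉xs x′∈)

  length-cartesianProduct : (xs : List A) (ys : List B) →
                            length (cartesianProduct xs ys) ≡ length xs ℕ.* length ys
  length-cartesianProduct [] ys = refl
  length-cartesianProduct (x ∷ xs) ys = trans (length-++ (map (x ,_) ys))
    (cong₂ ℕ._+_ (length-map (x ,_) ys) (length-cartesianProduct xs ys))

  ∈-concatMap-tabulate⁻ : {w : A → ℕ} (f : ∀ x → Fin (w x) → B) (xs : List A) {y : B} →
    y ∈ concatMap (λ x → tabulate (f x)) xs → ∃ λ x → ∃ λ i → y ≡ f x i
  ∈-concatMap-tabulate⁻ f xs y∈ with find (∈-concatMap⁻ (λ x → tabulate (f x)) {xs = xs} y∈)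
  ... | x , _ , p = x , ∈-tabulate⁻ p

  length-concatMap-tabulate : {w : A → ℕ} (f : ∀ x → Fin (w x) → B) (xs : List A) →
    length (concatMap (λ x → tabulate (f x)) xs) ≡ sum (map w xs)
  length-concatMap-tabulate f [] = refl
  length-concatMap-tabulate f (x ∷ xs) = trans (length-++ (tabulate (f x)))
    (cong₂ ℕ._+_ (length-tabulate (f x)) (length-concatMap-tabulate f xs))

  argmin : (g : A → ℤ) → ∀ xs → xs ≢ [] → ∃ λ m → m ∈ xs × (∀ {y} → y ∈ xs → g m ≤ g y)
  argmin g [] ne = contradiction refl ne
  argmin g (x ∷ []) _ = x , here refl , λ { (here refl) → ℤ.≤-refl }
  argmin g (x ∷ x′ ∷ xs) _ with argmin g (x′ ∷ xs) (λ ())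
  ... | m , m∈ , least with ℤ.≤-total (g x) (g m)
  ... | inj₁ le = x , here refl , λ { (here refl) → ℤ.≤-refl ; (there q) → ℤ.≤-trans le (least q) }
  ... | inj₂ ge = m , there m∈ , λ { (here refl) → ge ; (there q) → least q }

-- Walks against finite sets of tiles

iter-+ : ∀ d n m t → iter d n (iter d m t) ≡ iter d (n ℕ.+ m) t
iter-+ d zero m t = refl
iter-+ d (suc n) m t = cong (next d) (iter-+ d n m t)

-- As `pos` grows by one per step, the walk can meet a tile `u` only at time
-- `∣ pos d u - pos d t ∣`; beyond all these times it is off the list for good.
eventually-∉ : ∀ d t L → ∃ λ N → ∀ n → N ℕ.≤ n → iter d n t ∉ L
eventually-∉ d t [] = 0 , λ _ _ ()
eventually-∉ d t (u ∷ L) with eventually-∉ d t L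
... | N , out = suc ∣ pos d u - pos d t ∣ ℕ.⊔ N , λ
  { n le (here eq) → ℕ.<-irrefl (dist eq) (ℕ.≤-trans (ℕ.m≤m⊔n _ N) le)
  ; n le (there p) → out n (ℕ.≤-trans (ℕ.m≤n⊔m (suc ∣ pos d u - pos d t ∣) N) le) p }
  where
  dist : ∀ {n} → iter d n t ≡ u → ∣ pos d u - pos d t ∣ ≡ n
  dist {n} refl = cong ∣_∣ (trans (cong (_- pos d t) (pos-iter d n t)) (lem (pos d t) (+ n)))
    where lem : ∀ p m → p + m - p ≡ m
          lem = solve-∀

module _ (A : List Tile) where

  Escapes : Dir → Tile → Set
  Escapes d t = ∀ n → iter d n t ∉ A

  Escapes-path : ∀ {d t} → Escapes d t → ∀ n → Path (Out A) t (iter d n t)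
  Escapes-path esc zero = here (esc 0)
  Escapes-path {d} {t} esc (suc n) =
    Path-trans (Escapes-path esc n) (Path-nb (turn d (up (iter d n t))) (esc n) (esc (suc n)))

  Escapes⇒unbounded : ∀ {d t} → Escapes d t → ¬ BoundedComp A t
  Escapes⇒unbounded {d} {t} esc (L , bd) with eventually-∉ d t L
  ... | N , out = out N ℕ.≤-refl (bd (iter d N t) (Escapes-path esc N))

  BoundedComp-path : ∀ {t u} → Path (Out A) t u → BoundedComp A t → BoundedComp A u
  BoundedComp-path p (L , bd) = L , λ v q → bd v (Path-trans p q)

  walk : ∀ a s t → t ∉ A → ∀ N →
    (∃ λ u → Path (Out A) t u × c a u ≡ c a t × next (a , s) u ∈ A) ⊎
    Path (Out A) t (iter (a , s) N t)
  walk a s t t∉ zero = inj₂ (here t∉)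
  walk a s t t∉ (suc N) with walk a s t t∉ N
  ... | inj₁ hit = inj₁ hit
  ... | inj₂ p with iter (a , s) (suc N) t ∈? A
  ... | yes q = inj₁ (iter (a , s) N t , p , c-iter a s N t , q)
  ... | no q = inj₂ (Path-trans p (Path-nb (turn (a , s) (up (iter (a , s) N t))) (Path-end p) q))

  -- A walk that never met `A` would stay in the component of `t`, yet it leaves the finite list
  -- containing that component.
  bounded-hits : ∀ a s t → t ∉ A → BoundedComp A t →
    ∃ λ u → Path (Out A) t u × c a u ≡ c a t × next (a , s) u ∈ A
  bounded-hits a s t t∉ (L , bd) with eventually-∉ (a , s) t L
  ... | N , out with walk a s t t∉ N
  ... | inj₁ hit = hit
  ... | inj₂ p = contradiction (bd _ p) (out N ℕ.≤-refl)

  -- Search backwards from a time after which the walk avoids `A`: the last tile of `A` on it has a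
  -- free ray ahead, and hence faces the unbounded part of the complement.
  last-exit : ∀ a s t → t ∈ A → ∃ λ u → u ∈ A × c a u ≡ c a t × Escapes (a , s) (next (a , s) u)
  last-exit a s t t∈ with eventually-∉ (a , s) t A
  ... | N , out = search N out
    where
    search : ∀ N → (∀ n → N ℕ.≤ n → iter (a , s) n t ∉ A) →
             ∃ λ u → u ∈ A × c a u ≡ c a t × Escapes (a , s) (next (a , s) u)
    search zero out = contradiction t∈ (out 0 z≤n)
    search (suc N) out with iter (a , s) N t ∈? A
    ... | yes q = iter (a , s) N t , q , c-iter a s N t , λ n →
          subst (_∉ A) (sym (iter-+ (a , s) n (suc N) t)) (out (n ℕ.+ suc N) (ℕ.m≤n+m (suc N) n))
    ... | no q = search N λ n le → case n le (N ℕ.≟ n)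
      where
      case : ∀ n → N ℕ.≤ n → Dec (N ≡ n) → iter (a , s) n t ∉ A
      case n le (yes refl) = q
      case n le (no ne) = out n (ℕ.≤∧≢⇒< le ne)

-- Sides of tiles and the spanning tree count

Side : Set
Side = Tile × Dir

across : Side → Tile
across (t , d) = next d t

axes : List Axis
axes = X ∷ Y ∷ Z ∷ []

dirs : List Dir
dirs = cartesianProduct axes (true ∷ false ∷ [])

dirs-unique : Unique dirs
dirs-unique = toWitness {a? = unique? dirs} tt

∈-axes : ∀ a → a ∈ axes
∈-axes X = here refl
∈-axes Y = there (here refl)
∈-axes Z = there (there (here refl))

∈-bools : ∀ s → s ∈ true ∷ false ∷ []
∈-bools true = here refl
∈-bools false = there (here refl)

∈-dirs : ∀ d → d ∈ dirs
∈-dirs (a , s) = ∈-cartesianProduct⁺ (∈-axes a) (∈-bools s)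

-- The two directions of travel that leave a tile of orientation `b` through its edge `a`: the edge
-- is met in the strips of the other two axes, and the orientation fixes the sense.
crossings : Axis → Bool → Dir × Dir
crossings a b = (σ (σ a) , b) , (σ a , not b)

turn-same : ∀ a b → turn (a , b) b ≡ σ a
turn-same a true = refl
turn-same a false = refl

turn-diff : ∀ a b → turn (a , not b) b ≡ σ (σ a)
turn-diff a true = refl
turn-diff a false = refl

next-crossing₁ : ∀ a t → next (proj₁ (crossings a (up t))) t ≡ nb a t
next-crossing₁ a t = cong (λ e → nb e t) (trans (turn-same (σ (σ a)) (up t)) (σ³ a))

next-crossing₂ : ∀ a t → next (proj₂ (crossings a (up t))) t ≡ nb a t
next-crossing₂ a t = cong (λ e → nb e t) (trans (turn-diff (σ a) (up t)) (σ³ a))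

crossings-distinct : ∀ a b → proj₁ (crossings a b) ≢ proj₂ (crossings a b)
crossings-distinct X b ()
crossings-distinct Y b ()
crossings-distinct Z b ()

-- Every shared edge lies in two strips and is seen from both of its sides,
-- so each tile attached to a growing connected set contributes four sides.
module Growth (A : List Tile) (uniqueA : Unique A) (root : Tile) (root∈ : root ∈ A)
              (connected : ∀ t u → t ∈ A → u ∈ A → Path (_∈ A) t u) where

  record State : Set where
    field
      S : List Tile
      P : List Side
      uniqueS : Unique S
      uniqueP : Unique P
      S⊆A : ∀ {t} → t ∈ S → t ∈ A
      root∈S : root ∈ S
      inside : ∀ {e} → e ∈ P → proj₁ e ∈ S × across e ∈ S
      size-eq : 4 ℕ.+ length P ≡ 4 ℕ.* length S

  start : State
  start = record
    { S = root ∷ [] ; P = [] ; uniqueS = All.[] AllPairs.∷ AllPairs.[] ; uniqueP = AllPairs.[]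
    ; S⊆A = λ { (here refl) → root∈ } ; root∈S = here refl
    ; inside = λ () ; size-eq = refl }

  crossing : ∀ {S t u} → Path (_∈ A) t u → t ∈ S → u ∉ S →
             ∃ λ v → v ∈ S × ∃ λ a → nb a v ∉ S × nb a v ∈ A
  crossing (here _) t∈ u∉ = contradiction t∈ u∉
  crossing {S} {t} (step {u = v} _ adj p) t∈ u∉ with v ∈? S
  ... | yes v∈ = crossing p v∈ u∉
  ... | no v∉ with Adj⇒nb adj
  ... | a , refl = t , t∈ , a , v∉ , Path-start p

  extend : (st : State) → ∀ u a → u ∈ State.S st → nb a u ∉ State.S st → nb a u ∈ A →
           Σ State λ st′ → length (State.S st′) ≡ suc (length (State.S st))
  extend st u a u∈ v∉ v∈A = record
    { S = v ∷ S
    ; P = (u , d₁) ∷ (u , d₂) ∷ (v , e₁) ∷ (v , e₂) ∷ P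
    ; uniqueS = All.¬Any⇒All¬ S v∉ AllPairs.∷ uniqueS
    ; uniqueP =
        ((λ eq → crossings-distinct a (up u) (cong proj₂ eq)) All.∷ (u≢v ∘ cong proj₁) All.∷ (u≢v ∘ cong proj₁)
          All.∷ fresh (λ i → v∉ (subst (_∈ S) nd₁ (proj₂ i))))
        AllPairs.∷ ((u≢v ∘ cong proj₁) All.∷ (u≢v ∘ cong proj₁)
          All.∷ fresh (λ i → v∉ (subst (_∈ S) nd₂ (proj₂ i))))
        AllPairs.∷ ((λ eq → crossings-distinct a (up v) (cong proj₂ eq)) All.∷ fresh (v∉ ∘ proj₁))
        AllPairs.∷ fresh (v∉ ∘ proj₁)
        AllPairs.∷ uniqueP
    ; S⊆A = λ { (here refl) → v∈A ; (there p) → S⊆A p }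
    ; root∈S = there root∈S
    ; inside = λ
        { (here refl) → there u∈ , here nd₁
        ; (there (here refl)) → there u∈ , here nd₂
        ; (there (there (here refl))) → here refl , subst (_∈ v ∷ S) (sym ne₁) (there u∈)
        ; (there (there (there (here refl)))) → here refl , subst (_∈ v ∷ S) (sym ne₂) (there u∈)
        ; (there (there (there (there p)))) → there (proj₁ (inside p)) , there (proj₂ (inside p)) }
    ; size-eq = trans (cong (4 ℕ.+_) size-eq) (sym (ℕ.*-suc 4 (length S)))
    } , refl
    where
    open State st
    v = nb a u
    d₁ = proj₁ (crossings a (up u))
    d₂ = proj₂ (crossings a (up u))
    e₁ = proj₁ (crossings a (up v))
    e₂ = proj₂ (crossings a (up v))
    nd₁ = next-crossing₁ a u
    nd₂ = next-crossing₂ a u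
    ne₁ = trans (next-crossing₁ a v) (nb-involutive a u)
    ne₂ = trans (next-crossing₂ a v) (nb-involutive a u)
    u≢v : u ≢ v
    u≢v eq = v∉ (subst (_∈ S) eq u∈)
    -- Each new side has the new tile `v` on one of its two ends, whereas all recorded sides have
    -- both ends in `S`.
    fresh : ∀ {e} → ¬ (proj₁ e ∈ S × across e ∈ S) → All (λ e′ → e ≢ e′) P
    fresh ¬in = All.tabulate λ { p refl → ¬in (inside p) }

  TreeSides : Set
  TreeSides = Σ (List Side) λ P → Unique P × (∀ {e} → e ∈ P → proj₁ e ∈ A × across e ∈ A) ×
              4 ℕ.* length A ℕ.≤ 4 ℕ.+ length P

  grow : ∀ m → (st : State) → length A ℕ.≤ m ℕ.+ length (State.S st) → TreeSides
  grow m st le with All.all? (_∈? State.S st) A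
  ... | yes all = P , uniqueP , (λ p → S⊆A (proj₁ (inside p)) , S⊆A (proj₂ (inside p))) ,
        subst (4 ℕ.* length A ℕ.≤_) (sym size-eq)
          (ℕ.*-monoʳ-≤ 4 (Unique-⊆⇒length≤ uniqueA (All.lookup all)))
    where open State st
  ... | no ¬all with find (All.¬All⇒Any¬ (_∈? State.S st) A ¬all)
  ... | t , t∈A , t∉S with crossing (connected root t root∈ t∈A) (State.root∈S st) t∉S
  -- Out of fuel, `S` is at least as long as `A`, so `t ∷ S` would be a longer duplicate-free list
  -- inside `A`.
  grow zero st le | no ¬all | t , t∈A , t∉S | _ =
    contradiction (Unique-⊆⇒length≤ {xs = t ∷ State.S st} (All.¬Any⇒All¬ _ t∉S AllPairs.∷ State.uniqueS st)
      λ { (here refl) → t∈A ; (there p) → State.S⊆A st p }) (ℕ.<⇒≱ (s≤s le))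
  grow (suc m) st le | no ¬all | t , t∈A , t∉S | u , u∈ , a , v∉ , v∈ with extend st u a u∈ v∉ v∈
  ... | st′ , eq = grow m st′ (subst (length A ℕ.≤_)
          (trans (sym (ℕ.+-suc m _)) (cong (m ℕ.+_) (sym eq))) le)

  abstract
    treeSides : TreeSides
    treeSides = grow (length A) start (ℕ.m≤m+n (length A) 1)

-- The perimeter inequality

c-nb-≤ : ∀ a b t → c a (nb b t) ≤ c a t + 1ℤ
c-nb-≤ a b t with orbit a b
... | inj₁ refl = subst (_≤ c a t + 1ℤ) (sym (c-nb a t)) (ℤ.+-monoʳ-≤ (c a t) (sgn≤1 (up t)))
  where sgn≤1 : ∀ b → sgn b ≤ 1ℤ
        sgn≤1 true = -≤+
        sgn≤1 false = ℤ.≤-refl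
... | inj₂ (inj₁ refl) = subst (_≤ c a t + 1ℤ) (sym (c-nb-σ′ a t)) (ℤ.i≤i+j (c a t) 1ℤ)
... | inj₂ (inj₂ refl) = subst (_≤ c a t + 1ℤ) (sym (c-nb-σσ′ a t)) (ℤ.i≤i+j (c a t) 1ℤ)

-- A discrete intermediate value theorem: an index rises by at most one at each edge. It shows that
-- a connected set meets every strip between its extreme ones.
Path-intermediate : ∀ {P : Tile → Set} a {t u} v → Path P t u → c a t ≤ v → v ≤ c a u →
                    ∃ λ w → P w × c a w ≡ v
Path-intermediate a v (here p) le ge = _ , p , ℤ.≤-antisym le ge
Path-intermediate a {t} v (step p adj q) le ge with c a t ℤ.≟ v
... | yes eq = t , p , eq
... | no ne with Adj⇒nb adj
... | b , refl = Path-intermediate a v q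
  (ℤ.≤-trans (c-nb-≤ a b t)
    (subst (_≤ v) (ℤ.+-comm 1ℤ (c a t)) (ℤ.i<j⇒suc[i]≤j (ℤ.≤∧≢⇒< le ne)))) ge

module Perimeter (A : List Tile) (poly : IsPolyiamond A) (h : ℕ) (holes : HasHoles A h) where

  private
    uniqueA = proj₁ poly
    A≢[] = proj₁ (proj₂ poly)
    connected = proj₂ (proj₂ poly)
    f = proj₁ holes
    f-hole = proj₁ (proj₂ holes)
    f-distinct = proj₁ (proj₂ (proj₂ holes))

  abstract
    lowest : ∀ a → ∃ λ t → t ∈ A × (∀ {u} → u ∈ A → c a t ≤ c a u)
    lowest a = argmin {B = Tile} (c a) A A≢[]

    highest : ∀ a → ∃ λ t → t ∈ A × (∀ {u} → u ∈ A → - c a t ≤ - c a u)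
    highest a = argmin {B = Tile} (λ t → - c a t) A A≢[]

  lo hi : Axis → ℤ
  lo a = c a (proj₁ (lowest a))
  hi a = c a (proj₁ (highest a))

  lo≤ : ∀ a {t} → t ∈ A → lo a ≤ c a t
  lo≤ a = proj₂ (proj₂ (lowest a))

  ≤hi : ∀ a {t} → t ∈ A → c a t ≤ hi a
  ≤hi a p = ℤ.neg-cancel-≤ (proj₂ (proj₂ (highest a)) p)

  -- By `tile-in-strip`, this is the number of strips of axis `a` that meet `A`.
  width : Axis → ℕ
  width a = suc ∣ hi a - lo a ∣

  lo+width : ∀ a → lo a + + width a ≡ hi a + 1ℤ
  lo+width a = trans (cong (λ n → lo a + (1ℤ + n)) (ℤ.0≤i⇒+∣i∣≡i (gap (lo≤ a (proj₁ (proj₂ (highest a)))))))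
    (lem (lo a) (hi a))
    where lem : ∀ l h → l + (1ℤ + (h - l)) ≡ h + 1ℤ
          lem = solve-∀

  tile-in-strip : ∀ a (i : Fin (width a)) → ∃ λ t → t ∈ A × c a t ≡ lo a + + toℕ i
  tile-in-strip a i = Path-intermediate a (lo a + + toℕ i)
    (connected _ _ (proj₁ (proj₂ (lowest a))) (proj₁ (proj₂ (highest a))))
    (ℤ.i≤i+j (lo a) (+ toℕ i))
    (certify (gap le) (lem (lo a) (hi a) (+ toℕ i)))
    where
    lem : ∀ l h i → h - (l + i) ≡ h - l - i
    lem = solve-∀
    le : + toℕ i ≤ hi a - lo a
    le = subst (+ toℕ i ≤_) (ℤ.0≤i⇒+∣i∣≡i (gap (lo≤ a (proj₁ (proj₂ (highest a))))))
           (+≤+ (ℕ.s≤s⁻¹ (Fin.toℕ<n i)))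

  abstract
    holeHit : ∀ i a s → ∃ λ u → Path (Out A) (f i) u × c a u ≡ c a (f i) × next (a , s) u ∈ A
    holeHit i a s = bounded-hits A a s (f i) (proj₁ (f-hole i)) (proj₂ (f-hole i))

  -- The side is recorded from the tile of `A` that was hit, looking back. The tile across it then
  -- lies in the component of hole `i`, so the side determines both the hole and the direction.
  holeSide : Fin h × Dir → Side
  holeSide (i , a , s) = next (a , s) (proj₁ (holeHit i a s)) , opp (a , s)

  holeSide-inside : ∀ e → proj₁ (holeSide e) ∈ A
  holeSide-inside (i , a , s) = proj₂ (proj₂ (proj₂ (holeHit i a s)))

  holeSide-path : ∀ e → Path (Out A) (f (proj₁ e)) (across (holeSide e))
  holeSide-path (i , a , s) = subst (Path (Out A) (f i))
    (sym (next-opp (a , s) (proj₁ (holeHit i a s)))) (proj₁ (proj₂ (holeHit i a s)))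

  holeSide-injective : ∀ {e e′} → holeSide e ≡ holeSide e′ → e ≡ e′
  holeSide-injective {e@(i , d)} {e′@(i′ , d′)} eq =
    cong₂ _,_
      (f-distinct i i′ (Path-trans (holeSide-path e)
        (Path-sym (subst (λ r → Path (Out A) (f i′) (across r)) (sym eq) (holeSide-path e′)))))
      (trans (sym (opp-involutive d)) (trans (cong opp (cong proj₂ eq)) (opp-involutive d′)))

  holeSides : List Side
  holeSides = map holeSide (cartesianProduct (allFin h) dirs)

  abstract
    outerExit : ∀ a s (i : Fin (width a)) →
                ∃ λ u → u ∈ A × c a u ≡ lo a + + toℕ i × Escapes A (a , s) (next (a , s) u)
    outerExit a s i with tile-in-strip a i
    ... | t , t∈ , eq with last-exit A a s t t∈
    ... | u , u∈ , eq′ , esc = u , u∈ , trans eq′ eq , esc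

  outerSide : ∀ d → Fin (width (proj₁ d)) → Side
  outerSide (a , s) i = proj₁ (outerExit a s i) , (a , s)

  outerSide-inside : ∀ d i → proj₁ (outerSide d i) ∈ A
  outerSide-inside (a , s) i = proj₁ (proj₂ (outerExit a s i))

  outerSide-strip : ∀ d i → c (proj₁ d) (proj₁ (outerSide d i)) ≡ lo (proj₁ d) + + toℕ i
  outerSide-strip (a , s) i = proj₁ (proj₂ (proj₂ (outerExit a s i)))

  outerSide-escapes : ∀ d i → Escapes A d (across (outerSide d i))
  outerSide-escapes (a , s) i = proj₂ (proj₂ (proj₂ (outerExit a s i)))

  outerSide-injective : ∀ d {i j} → outerSide d i ≡ outerSide d j → i ≡ j
  outerSide-injective d@(a , _) {i} {j} eq = Fin.toℕ-injective (ℤ.+-injective (∙-cancelˡ (lo a) _ _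
    (trans (sym (outerSide-strip d i)) (trans (cong (λ e → c a (proj₁ e)) eq) (outerSide-strip d j)))))

  outerSides : List Side
  outerSides = concatMap (λ d → tabulate (outerSide d)) dirs

  ∈-outerSides⁻ : ∀ {e} → e ∈ outerSides → ∃ λ d → ∃ λ i → e ≡ outerSide d i
  ∈-outerSides⁻ = ∈-concatMap-tabulate⁻ outerSide dirs

  ∈-holeSides⁻ : ∀ {e} → e ∈ holeSides → ∃ λ j → e ≡ holeSide j
  ∈-holeSides⁻ e∈ = let (j , _ , eq) = ∈-map⁻ holeSide e∈ in j , eq

  boundary : ∀ {e} → e ∈ holeSides ++ outerSides → proj₁ e ∈ A × across e ∉ A
  boundary = Sum.[ fromHole ∘ ∈-holeSides⁻ , fromOuter ∘ ∈-outerSides⁻ ] ∘ ∈-++⁻ holeSides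
    where
    fromHole : ∀ {e} → (∃ λ j → e ≡ holeSide j) → proj₁ e ∈ A × across e ∉ A
    fromHole (j , eq) = subst (λ e → proj₁ e ∈ A × across e ∉ A) (sym eq)
      (holeSide-inside j , Path-end (holeSide-path j))
    fromOuter : ∀ {e} → (∃ λ d → ∃ λ i → e ≡ outerSide d i) → proj₁ e ∈ A × across e ∉ A
    fromOuter (d , i , eq) = subst (λ e → proj₁ e ∈ A × across e ∉ A) (sym eq)
      (outerSide-inside d i , outerSide-escapes d i 0)

  -- Hole sides differ in the component they face or in their direction, outer sides in direction or
  -- strip. A hole side faces a bounded component, an outer side a ray to infinity, so no side is of
  -- both kinds.
  boundary-unique : Unique (holeSides ++ outerSides)
  boundary-unique = Unique.++⁺
    (Unique.map⁺ holeSide-injective (Unique.cartesianProduct⁺ (Unique.allFin⁺ h) dirs-unique))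
    (concatMap-unique proj₂ (λ d → tabulate (outerSide d)) (λ d → Unique.tabulate⁺ (outerSide-injective d)) key dirs-unique)
    (λ (p , q) → disjoint (∈-holeSides⁻ p) (∈-outerSides⁻ q))
    where
    key : ∀ d {e} → e ∈ tabulate (outerSide d) → proj₂ e ≡ d
    key d p = cong proj₂ (proj₂ (∈-tabulate⁻ {f = outerSide d} p))
    disjoint : ∀ {e} → (∃ λ j → e ≡ holeSide j) → (∃ λ d → ∃ λ i → e ≡ outerSide d i) → ⊥
    disjoint (j , eq) (d , i , eq′) = Escapes⇒unbounded A (outerSide-escapes d i)
      (subst (λ e → BoundedComp A (across e)) (trans (sym eq) eq′)
        (BoundedComp-path A (holeSide-path j) (proj₂ (f-hole (proj₁ j)))))

  open Growth A uniqueA (proj₁ (lowest X)) (proj₁ (proj₂ (lowest X))) connected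

  -- Across a tree side lies a tile of `A`, across a hole side or an outer side none; so all are
  -- distinct sides among the six of each tile.
  allSides-bound : (T : TreeSides) →
    length (proj₁ T) ℕ.+ length (holeSides ++ outerSides) ℕ.≤ length (cartesianProduct A dirs)
  allSides-bound (P , uniqueP , inside , _) = subst (ℕ._≤ length (cartesianProduct A dirs)) (length-++ P)
    (Unique-⊆⇒length≤
      (Unique.++⁺ uniqueP boundary-unique (λ (p , q) → proj₂ (boundary q) (proj₂ (inside p))))
      (λ e∈ → side∈ (Sum.[ (λ p → proj₁ (inside p)) , (λ q → proj₁ (boundary q)) ] (∈-++⁻ P e∈))))
    where
    side∈ : ∀ {e} → proj₁ e ∈ A → e ∈ cartesianProduct A dirs
    side∈ {e} p = ∈-cartesianProduct⁺ p (∈-dirs (proj₂ e))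

  length-holeSides : length holeSides ≡ h ℕ.* 6
  length-holeSides = trans (length-map holeSide (cartesianProduct (allFin h) dirs))
    (trans (length-cartesianProduct (allFin h) dirs) (cong (ℕ._* 6) (length-tabulate {n = h} (λ i → i))))

  length-outerSides : length outerSides ≡ 2 ℕ.* (width X ℕ.+ width Y ℕ.+ width Z)
  length-outerSides = trans (length-concatMap-tabulate outerSide dirs) (lem (width X) (width Y) (width Z))
    where
    lem : ∀ x y z → x ℕ.+ (x ℕ.+ (y ℕ.+ (y ℕ.+ (z ℕ.+ (z ℕ.+ 0))))) ≡ 2 ℕ.* (x ℕ.+ y ℕ.+ z)
    lem = solveℕ-∀

  perimeter-bound : 3 ℕ.* h ℕ.+ (width X ℕ.+ width Y ℕ.+ width Z) ℕ.≤ length A ℕ.+ 2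
  perimeter-bound = combine (length A) (proj₂ (proj₂ (proj₂ treeSides)))
    (subst₂ ℕ._≤_ (cong (length (proj₁ treeSides) ℕ.+_)
                    (trans (length-++ holeSides) (cong₂ ℕ._+_ length-holeSides length-outerSides)))
                  (length-cartesianProduct A dirs) (allSides-bound treeSides))
    where
    combine : ∀ n {p w} → 4 ℕ.* n ℕ.≤ 4 ℕ.+ p → p ℕ.+ (h ℕ.* 6 ℕ.+ 2 ℕ.* w) ℕ.≤ n ℕ.* 6 →
              3 ℕ.* h ℕ.+ w ℕ.≤ n ℕ.+ 2
    combine n {p} {w} le₁ le₂ = ℕ.*-cancelˡ-≤ 2 (ℕ.+-cancelˡ-≤ (4 ℕ.* n) _ _ (begin
      4 ℕ.* n ℕ.+ 2 ℕ.* (3 ℕ.* h ℕ.+ w)          ≤⟨ ℕ.+-monoˡ-≤ _ le₁ ⟩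
      4 ℕ.+ p ℕ.+ 2 ℕ.* (3 ℕ.* h ℕ.+ w)          ≡⟨ lem₁ p h w ⟩
      4 ℕ.+ (p ℕ.+ (h ℕ.* 6 ℕ.+ 2 ℕ.* w))         ≤⟨ ℕ.+-monoʳ-≤ 4 le₂ ⟩
      4 ℕ.+ n ℕ.* 6                               ≡⟨ lem₂ n ⟩
      4 ℕ.* n ℕ.+ 2 ℕ.* (n ℕ.+ 2)                 ∎))
      where
      open ℕ.≤-Reasoning
      lem₁ : ∀ p h w → 4 ℕ.+ p ℕ.+ 2 ℕ.* (3 ℕ.* h ℕ.+ w) ≡ 4 ℕ.+ (p ℕ.+ (h ℕ.* 6 ℕ.+ 2 ℕ.* w))
      lem₁ = solveℕ-∀
      lem₂ : ∀ n → 4 ℕ.+ n ℕ.* 6 ≡ 4 ℕ.* n ℕ.+ 2 ℕ.* (n ℕ.+ 2)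
      lem₂ = solveℕ-∀

  tileOrHole : List Tile
  tileOrHole = A ++ tabulate f

  tileOrHole-unique : Unique tileOrHole
  tileOrHole-unique = Unique.++⁺ uniqueA
    (Unique.tabulate⁺ λ {i} {j} eq →
      f-distinct i j (subst (Path (Out A) (f i)) eq (here (proj₁ (f-hole i)))))
    disjoint
    where
    disjoint : ∀ {t} → t ∈ A × t ∈ tabulate f → ⊥
    disjoint (p , q) with ∈-tabulate⁻ q
    ... | i , refl = proj₁ (f-hole i) p

  -- The walk from a hole inside any of its strips runs into `A`, so the holes do not enlarge the
  -- bounding hexagon of `A`.
  tileOrHole-strip : ∀ a {t} → t ∈ tileOrHole → ∃ λ u → u ∈ A × c a u ≡ c a t
  tileOrHole-strip a {t} t∈ with ∈-++⁻ A t∈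
  ... | inj₁ p = t , p , refl
  ... | inj₂ q with ∈-tabulate⁻ q
  ... | i , refl with bounded-hits A a true (f i) (proj₁ (f-hole i)) (proj₂ (f-hole i))
  ... | u , _ , eq , u∈ = next (a , true) u , u∈ , trans (c-next a true u) eq

  tileOrHole-≥ : ∀ a {t} → t ∈ tileOrHole → lo a ≤ c a t
  tileOrHole-≥ a t∈ with tileOrHole-strip a t∈
  ... | u , u∈ , eq = subst (lo a ≤_) eq (lo≤ a u∈)

  tileOrHole-≤ : ∀ a {t} → t ∈ tileOrHole → c a t ≤ hi a
  tileOrHole-≤ a t∈ with tileOrHole-strip a t∈
  ... | u , u∈ , eq = subst (_≤ hi a) eq (≤hi a u∈)

  length-tileOrHole : length tileOrHole ≡ length A ℕ.+ h
  length-tileOrHole = trans (length-++ A) (cong (length A ℕ.+_) (length-tabulate f))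

-- Counting tiles of a hexagon

Cell : Set
Cell = ℕ × ℕ × Bool

-- The strip of axis `Z`, counted from an acute corner of a parallelogram; the triangle cut off at
-- that corner is then a sublevel set.
level : Cell → ℕ
level (i , j , true) = i ℕ.+ j
level (i , j , false) = suc (i ℕ.+ j)

upCell downCell : ℕ → ℕ → Cell
upCell l i = i , l ℕ.∸ i , true
downCell l i = i , l ℕ.∸ suc i , false

upLayer downLayer layer corner : ℕ → List Cell
upLayer l = applyUpTo (upCell l) (suc l)
downLayer l = applyUpTo (downCell l) l
layer l = upLayer l ++ downLayer l
corner zero = []
corner (suc l) = layer l ++ corner l

layer-level : ∀ l {t} → t ∈ layer l → level t ≡ l
layer-level l = Sum.[ fromUp , fromDown ] ∘ ∈-++⁻ (upLayer l)
  where
  fromUp : ∀ {t} → t ∈ upLayer l → level t ≡ l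
  fromUp p with ∈-applyUpTo⁻ (upCell l) p
  ... | i , i< , refl = ℕ.m+[n∸m]≡n (ℕ.s≤s⁻¹ i<)
  fromDown : ∀ {t} → t ∈ downLayer l → level t ≡ l
  fromDown p with ∈-applyUpTo⁻ (downCell l) p
  ... | i , i< , refl = ℕ.m+[n∸m]≡n i<

corner-level : ∀ l {t} → t ∈ corner l → level t ℕ.< l
corner-level (suc l) {t} = Sum.[ (λ p → ℕ.≤-reflexive (cong suc (layer-level l p)))
                               , (λ p → ℕ.m≤n⇒m≤1+n (corner-level l p)) ] ∘ ∈-++⁻ (layer l)

layer-unique : ∀ l → Unique (layer l)
layer-unique l = Unique.++⁺
  (Unique.applyUpTo⁺₁ (upCell l) (suc l) (λ i<j _ eq → ℕ.<⇒≢ i<j (cong proj₁ eq)))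
  (Unique.applyUpTo⁺₁ (downCell l) l (λ i<j _ eq → ℕ.<⇒≢ i<j (cong proj₁ eq)))
  (λ (p , q) → disjoint (∈-applyUpTo⁻ (upCell l) p)
                        (∈-applyUpTo⁻ (downCell l) q))
  where
  disjoint : ∀ {t} → (∃ λ i → i ℕ.< suc l × t ≡ (i , l ℕ.∸ i , true)) →
             (∃ λ i → i ℕ.< l × t ≡ (i , l ℕ.∸ suc i , false)) → ⊥
  disjoint (_ , _ , refl) (_ , _ , ())

corner-unique : ∀ l → Unique (corner l)
corner-unique zero = AllPairs.[]
corner-unique (suc l) = Unique.++⁺ (layer-unique l) (corner-unique l)
  (λ (p , q) → ℕ.<-irrefl (layer-level l p) (corner-level l q))

length-corner : ∀ l → length (corner l) ≡ l ℕ.* l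
length-corner zero = refl
length-corner (suc l) = trans (length-++ (layer l)) (trans
  (cong₂ ℕ._+_ (trans (length-++ (upLayer l)) (cong₂ ℕ._+_ (length-applyUpTo (upCell l) (suc l)) (length-applyUpTo (downCell l) l)))
               (length-corner l))
  (lem l))
  where lem : ∀ l → suc l ℕ.+ l ℕ.+ l ℕ.* l ≡ suc l ℕ.* suc l
        lem = solveℕ-∀

+-+-injective : ∀ o {i j} → o + + i ≡ o + + j → i ≡ j
+-+-injective o eq = ℤ.+-injective (∙-cancelˡ o _ _ eq)

module Box (ox oy : ℤ) (a b : ℕ) where

  -- `fromHigh` is `fromLow` followed by the half-turn of the parallelogram, which exchanges the
  -- orientations; so one count of `corner` serves both acute corners.
  fromLow fromHigh : Cell → Tile
  fromLow (i , j , β) = ox + + i , oy + + j , β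
  fromHigh (i , j , β) = ox + + a - 1ℤ - + i , oy + + b - 1ℤ - + j , not β

  fromLow-injective : ∀ {s t} → fromLow s ≡ fromLow t → s ≡ t
  fromLow-injective eq = cong₂ _,_ (+-+-injective ox (cong proj₁ eq))
    (cong₂ _,_ (+-+-injective oy (cong (proj₁ ∘ proj₂) eq)) (cong (proj₂ ∘ proj₂) eq))

  fromHigh-injective : ∀ {s t} → fromHigh s ≡ fromHigh t → s ≡ t
  fromHigh-injective eq = cong₂ _,_ (unminus (ox + + a - 1ℤ) (cong proj₁ eq))
    (cong₂ _,_ (unminus (oy + + b - 1ℤ) (cong (proj₁ ∘ proj₂) eq)) (Bool.not-injective (cong (proj₂ ∘ proj₂) eq)))
    where
    unminus : ∀ o {i j} → o - + i ≡ o - + j → i ≡ j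
    unminus o eq = ℤ.+-injective (⁻¹-injective (∙-cancelˡ o _ _ eq))

  c-fromLow : ∀ t → c Z (fromLow t) ≡ - (ox + oy + + level t)
  c-fromLow (i , j , true) = lem ox oy (+ i) (+ j)
    where lem : ∀ ox oy i j → - (ox + i + (oy + j)) ≡ - (ox + oy + (i + j))
          lem = solve-∀
  c-fromLow (i , j , false) = lem ox oy (+ i) (+ j)
    where lem : ∀ ox oy i j → - (1ℤ + (ox + i) + (oy + j)) ≡ - (ox + oy + (1ℤ + (i + j)))
          lem = solve-∀

  c-fromHigh : ∀ t → c Z (fromHigh t) ≡ 1ℤ - ox - oy - + a - + b + + level t
  c-fromHigh (i , j , true) = lem ox oy (+ a) (+ b) (+ i) (+ j)
    where lem : ∀ ox oy a b i j → - (1ℤ + (ox + a - 1ℤ - i) + (oy + b - 1ℤ - j)) ≡ 1ℤ - ox - oy - a - b + (i + j)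
          lem = solve-∀
  c-fromHigh (i , j , false) = lem ox oy (+ a) (+ b) (+ i) (+ j)
    where lem : ∀ ox oy a b i j → - ((ox + a - 1ℤ - i) + (oy + b - 1ℤ - j)) ≡ 1ℤ - ox - oy - a - b + (1ℤ + (i + j))
          lem = solve-∀

  cells : List Cell
  cells = cartesianProduct (upTo a) (cartesianProduct (upTo b) (true ∷ false ∷ []))

  parallelogram : List Tile
  parallelogram = map fromLow cells

  cells-unique : Unique cells
  cells-unique = Unique.cartesianProduct⁺ (Unique.upTo⁺ a)
    (Unique.cartesianProduct⁺ (Unique.upTo⁺ b) (((λ ()) All.∷ All.[]) AllPairs.∷ All.[] AllPairs.∷ AllPairs.[]))

  parallelogram-unique : Unique parallelogram
  parallelogram-unique = Unique.map⁺ fromLow-injective cells-unique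

  length-parallelogram : length parallelogram ≡ a ℕ.* (b ℕ.* 2)
  length-parallelogram = trans (length-map fromLow cells)
    (trans (length-cartesianProduct (upTo a) _)
      (cong₂ ℕ._*_ (length-upTo a)
        (trans (length-cartesianProduct (upTo b) _) (cong (ℕ._* 2) (length-upTo b)))))

  fromLow-∈ : ∀ {i j} β → i ℕ.< a → j ℕ.< b → fromLow (i , j , β) ∈ parallelogram
  fromLow-∈ β i< j< = ∈-map⁺ fromLow
    (∈-cartesianProduct⁺ (∈-upTo⁺ i<) (∈-cartesianProduct⁺ (∈-upTo⁺ j<) (∈-bools β)))

  coordinate : ∀ o n x → o ≤ x → x + 1ℤ ≤ o + + n → ∃ λ i → i ℕ.< n × o + + i ≡ x
  coordinate o n x ge lt = ∣ x - o ∣ , ℤ.drop‿+≤+ (certify (gap lt) lem₁) , lem₂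
    where
    eq : + ∣ x - o ∣ ≡ x - o
    eq = ℤ.0≤i⇒+∣i∣≡i (gap ge)
    lem₁ : + n - (1ℤ + + ∣ x - o ∣) ≡ o + + n - (x + 1ℤ)
    lem₁ = trans (cong (λ e → + n - (1ℤ + e)) eq) (lem (+ n) x o)
      where lem : ∀ n x o → n - (1ℤ + (x - o)) ≡ o + n - (x + 1ℤ)
            lem = solve-∀
    lem₂ : o + + ∣ x - o ∣ ≡ x
    lem₂ = trans (cong (λ e → o + e) eq) (lem o x)
      where lem : ∀ o x → o + (x - o) ≡ x
            lem = solve-∀

  record InBox (t : Tile) : Set where
    constructor inBox
    field
      X≥ : ox ≤ c X t
      X< : c X t + 1ℤ ≤ ox + + a
      Y≥ : oy ≤ c Y t
      Y< : c Y t + 1ℤ ≤ oy + + b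

  InBox⇒∈ : ∀ {t} → InBox t → t ∈ parallelogram
  InBox⇒∈ {x , y , β} (inBox x≥ x< y≥ y<)
    with coordinate ox a x x≥ x< | coordinate oy b y y≥ y<
  ... | i , i< , refl | j , j< , refl = fromLow-∈ β i< j<

  cell-<ˡ : ∀ {l i j} β → level (i , j , β) ℕ.< l → i ℕ.< l
  cell-<ˡ true lt = ℕ.≤-<-trans (ℕ.m≤m+n _ _) lt
  cell-<ˡ false lt = ℕ.≤-<-trans (ℕ.m≤n⇒m≤1+n (ℕ.m≤m+n _ _)) lt

  cell-<ʳ : ∀ {l i j} β → level (i , j , β) ℕ.< l → j ℕ.< l
  cell-<ʳ true lt = ℕ.≤-<-trans (ℕ.m≤n+m _ _) lt
  cell-<ʳ false lt = ℕ.≤-<-trans (ℕ.m≤n⇒m≤1+n (ℕ.m≤n+m _ _)) lt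

  fromHigh-InBox : ∀ {i j} β → i ℕ.< a → j ℕ.< b → InBox (fromHigh (i , j , β))
  fromHigh-InBox {i} {j} β i< j< = inBox (above ox i<) (below ox) (above oy j<) (below oy)
    where
    above : ∀ o {i n} → i ℕ.< n → o ≤ o + + n - 1ℤ - + i
    above o {i} {n} i<n = certify (gap (+≤+ i<n)) (lem o (+ i) (+ n))
      where lem : ∀ o i n → o + n - 1ℤ - i - o ≡ n - (1ℤ + i)
            lem = solve-∀
    below : ∀ o {i n} → o + + n - 1ℤ - + i + 1ℤ ≤ o + + n
    below o {i} {n} = certify (+≤+ (z≤n {i})) (lem o (+ i) (+ n))
      where lem : ∀ o i n → o + n - (o + n - 1ℤ - i + 1ℤ) ≡ i
            lem = solve-∀

  -- A hexagon is the parallelogram minus its two acute corners, which are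
  -- triangles with l² and u² tiles.
  hexagon-count : ∀ {l u} (L : List Tile) → Unique L → (∀ {t} → t ∈ L → InBox t) →
    (∀ {t} → t ∈ L → c Z t ≤ - (ox + oy + + l)) →
    (∀ {t} → t ∈ L → 1ℤ - ox - oy - + a - + b + + u ≤ c Z t) →
    l ℕ.≤ a → l ℕ.≤ b → u ℕ.≤ a → u ℕ.≤ b →
    length L ℕ.+ (l ℕ.* l ℕ.+ u ℕ.* u) ℕ.≤ a ℕ.* (b ℕ.* 2)
  hexagon-count {l} {u} L uniqueL L-box L≤ L≥ l≤a l≤b u≤a u≤b =
    subst₂ ℕ._≤_ total-length length-parallelogram (Unique-⊆⇒length≤ unique sub)
    where
    low = map fromLow (corner l)
    high = map fromHigh (corner u)

    low> : ∀ {t} → t ∈ low → - (ox + oy + + l) + 1ℤ ≤ c Z t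
    low> p with ∈-map⁻ fromLow p
    ... | q , q∈ , refl = certify (gap (+≤+ (corner-level l q∈)))
      (trans (cong (_- (- (ox + oy + + l) + 1ℤ)) (c-fromLow q)) (lem ox oy (+ l) (+ level q)))
      where lem : ∀ ox oy l v → - (ox + oy + v) - (- (ox + oy + l) + 1ℤ) ≡ l - (1ℤ + v)
            lem = solve-∀

    high< : ∀ {t} → t ∈ high → c Z t + 1ℤ ≤ 1ℤ - ox - oy - + a - + b + + u
    high< p with ∈-map⁻ fromHigh p
    ... | q , q∈ , refl = certify (gap (+≤+ (corner-level u q∈)))
      (trans (cong (λ e → 1ℤ - ox - oy - + a - + b + + u - (e + 1ℤ)) (c-fromHigh q))
        (lem (1ℤ - ox - oy - + a - + b) (+ u) (+ level q)))
      where lem : ∀ k u v → k + u - (k + v + 1ℤ) ≡ u - (1ℤ + v)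
            lem = solve-∀

    low-high : ∀ {t} → t ∈ low → t ∈ high → ⊥
    -- The two corners occupy disjoint ranges of `Z` strips because l + u ≤ a + b.
    low-high {t} p q = absurd-by (gap (low> p) ⊕ gap (high< q) ⊕ gap (+≤+ l≤a) ⊕ gap (+≤+ u≤b))
      (lem ox oy (+ l) (+ u) (+ a) (+ b) (c Z t))
      where lem : ∀ ox oy l u a b z → z - (- (ox + oy + l) + 1ℤ) + (1ℤ - ox - oy - a - b + u - (z + 1ℤ))
                    + (a - l) + (b - u) ≡ -1ℤ
            lem = solve-∀

    low-L : ∀ {t} → t ∈ low → t ∈ L → ⊥
    low-L {t} p q = absurd-by (gap (low> p) ⊕ gap (L≤ q)) (lem (- (ox + oy + + l)) (c Z t))
      where lem : ∀ k z → z - (k + 1ℤ) + (k - z) ≡ -1ℤ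
            lem = solve-∀

    high-L : ∀ {t} → t ∈ high → t ∈ L → ⊥
    high-L {t} p q = absurd-by (gap (high< p) ⊕ gap (L≥ q)) (lem (1ℤ - ox - oy - + a - + b + + u) (c Z t))
      where lem : ∀ k z → k - (z + 1ℤ) + (z - k) ≡ -1ℤ
            lem = solve-∀

    unique : Unique (L ++ low ++ high)
    unique = Unique.++⁺ uniqueL
      (Unique.++⁺ (Unique.map⁺ fromLow-injective (corner-unique l))
                  (Unique.map⁺ fromHigh-injective (corner-unique u))
                  (λ (p , q) → low-high p q))
      (λ (p , q) → Sum.[ (λ q₁ → low-L q₁ p) , (λ q₂ → high-L q₂ p) ] (∈-++⁻ low q))

    low-∈ : ∀ {t} → t ∈ low → t ∈ parallelogram
    low-∈ p with ∈-map⁻ fromLow p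
    ... | (i , j , β) , q∈ , refl = fromLow-∈ β
      (ℕ.<-≤-trans (cell-<ˡ β (corner-level l q∈)) l≤a) (ℕ.<-≤-trans (cell-<ʳ β (corner-level l q∈)) l≤b)

    high-∈ : ∀ {t} → t ∈ high → t ∈ parallelogram
    high-∈ p with ∈-map⁻ fromHigh p
    ... | (i , j , β) , q∈ , refl = InBox⇒∈ (fromHigh-InBox β
      (ℕ.<-≤-trans (cell-<ˡ β (corner-level u q∈)) u≤a) (ℕ.<-≤-trans (cell-<ʳ β (corner-level u q∈)) u≤b))

    sub : ∀ {t} → t ∈ L ++ low ++ high → t ∈ parallelogram
    sub p = Sum.[ InBox⇒∈ ∘ L-box , Sum.[ low-∈ , high-∈ ] ∘ ∈-++⁻ low ] (∈-++⁻ L p)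

    total-length : length (L ++ low ++ high) ≡ length L ℕ.+ (l ℕ.* l ℕ.+ u ℕ.* u)
    total-length = trans (length-++ L) (cong (length L ℕ.+_) (trans (length-++ low)
      (cong₂ ℕ._+_ (trans (length-map fromLow (corner l)) (length-corner l))
                   (trans (length-map fromHigh (corner u)) (length-corner u)))))

-- The isoperimetric inequality for hexagons

0≤i*i : ∀ i → 0ℤ ≤ i * i
0≤i*i (+ n) = subst (0ℤ ≤_) (ℤ.pos-* n n) (+≤+ z≤n)
0≤i*i -[1+ n ] = +≤+ z≤n

0≤i*j : ∀ {i j} → 0ℤ ≤ i → 0ℤ ≤ j → 0ℤ ≤ i * j
0≤i*j {+ m} {+ n} _ _ = subst (0ℤ ≤_) (ℤ.pos-* m n) (+≤+ z≤n)

-- A sum of squares certificate: the difference is six times the slack in the tile count plus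
-- multiples of three squares. The squares all vanish when a = b, l = u and a = 2l, which is the
-- regular hexagon.
isoperimetric : ∀ {N a b l u w} → N + (l * l + u * u) ≤ a * (b * + 2) → w ≡ a + b - l - u →
                + 6 * N ≤ (a + b + w) * (a + b + w)
isoperimetric {N} {a} {b} {l} {u} le refl = certify
  (0≤i*j {+ 6} (+≤+ z≤n) (gap le) ⊕ 0≤i*i (a + b - + 2 * (l + u))
    ⊕ 0≤i*j {+ 3} (+≤+ z≤n) (0≤i*i (a - b)) ⊕ 0≤i*j {+ 3} (+≤+ z≤n) (0≤i*i (l - u)))
  (lem N a b l u)
  where
  lem : ∀ N a b l u →
    (a + b + (a + b - l - u)) * (a + b + (a + b - l - u)) - + 6 * N ≡
    + 6 * (a * (b * + 2) - (N + (l * l + u * u)))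
      + (a + b - + 2 * (l + u)) * (a + b - + 2 * (l + u))
      + + 3 * ((a - b) * (a - b)) + + 3 * ((l - u) * (l - u))
  lem = solve-∀

-- The values of h_k and n_k

-- This is T = k(k - 1)/2, built up as the holes are, ring by ring. It makes h_k = 3T and n_k = 9T +
-- 6k - 2, free of halves.
triangular : ℕ → ℕ
triangular zero = 0
triangular (suc q) = q ℕ.+ triangular q

2*triangular : ∀ k → 2 ℕ.* triangular k ℕ.+ k ≡ k ℕ.* k
2*triangular zero = refl
2*triangular (suc q) = trans (lem₁ q (triangular q)) (trans (cong (λ e → e ℕ.+ 2 ℕ.* q ℕ.+ 1) (2*triangular q)) (lem₂ q))
  where
  lem₁ : ∀ q t → 2 ℕ.* (q ℕ.+ t) ℕ.+ suc q ≡ 2 ℕ.* t ℕ.+ q ℕ.+ 2 ℕ.* q ℕ.+ 1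
  lem₁ = solveℕ-∀
  lem₂ : ∀ q → q ℕ.* q ℕ.+ 2 ℕ.* q ℕ.+ 1 ≡ suc q ℕ.* suc q
  lem₂ = solveℕ-∀

hk≡ : ∀ k → hk k ≡ 3 ℕ.* triangular k
hk≡ k = trans (cong (_/ 2) eq) (m*n/n≡m (3 ℕ.* triangular k) 2)
  where
  eq : 3 ℕ.* k ℕ.* k ℕ.∸ 3 ℕ.* k ≡ 3 ℕ.* triangular k ℕ.* 2
  eq = trans (cong (ℕ._∸ 3 ℕ.* k)
               (trans (lem₁ k) (trans (cong (3 ℕ.*_) (sym (2*triangular k))) (lem₂ k (triangular k)))))
             (ℕ.m+n∸n≡m (3 ℕ.* triangular k ℕ.* 2) (3 ℕ.* k))
    where
    lem₁ : ∀ k → 3 ℕ.* k ℕ.* k ≡ 3 ℕ.* (k ℕ.* k)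
    lem₁ = solveℕ-∀
    lem₂ : ∀ k t → 3 ℕ.* (2 ℕ.* t ℕ.+ k) ≡ 3 ℕ.* t ℕ.* 2 ℕ.+ 3 ℕ.* k
    lem₂ = solveℕ-∀

nk≡ : ∀ k → nk k ≡ 9 ℕ.* triangular k ℕ.+ 6 ℕ.* k ℕ.∸ 2
nk≡ k = trans (cong (_/ 2) eq) (m*n/n≡m (9 ℕ.* triangular k ℕ.+ 6 ℕ.* k ℕ.∸ 2) 2)
  where
  eq : 9 ℕ.* k ℕ.* k ℕ.+ 3 ℕ.* k ℕ.∸ 4 ≡ (9 ℕ.* triangular k ℕ.+ 6 ℕ.* k ℕ.∸ 2) ℕ.* 2
  eq = trans (cong (ℕ._∸ 4)
               (trans (lem₁ k) (trans (cong (λ e → 9 ℕ.* e ℕ.+ 3 ℕ.* k) (sym (2*triangular k))) (lem₂ k (triangular k)))))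
             (sym (ℕ.*-distribʳ-∸ 2 (9 ℕ.* triangular k ℕ.+ 6 ℕ.* k) 2))
    where
    lem₁ : ∀ k → 9 ℕ.* k ℕ.* k ℕ.+ 3 ℕ.* k ≡ 9 ℕ.* (k ℕ.* k) ℕ.+ 3 ℕ.* k
    lem₁ = solveℕ-∀
    lem₂ : ∀ k t → 9 ℕ.* (2 ℕ.* t ℕ.+ k) ℕ.+ 3 ℕ.* k ≡ (9 ℕ.* t ℕ.+ 6 ℕ.* k) ℕ.* 2
    lem₂ = solveℕ-∀

total≤0 : ∀ b → total b ≤ 0ℤ
total≤0 true = ℤ.≤-refl
total≤0 false = -≤+

-1≤total : ∀ b → -1ℤ ≤ total b
-1≤total true = -≤+
-1≤total false = ℤ.≤-refl

c-sum≤0 : ∀ t → c X t + c Y t + c Z t ≤ 0ℤ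
c-sum≤0 t = subst (_≤ 0ℤ) (sym (c-sum X t)) (total≤0 (up t))

-1≤c-sum : ∀ t → -1ℤ ≤ c X t + c Y t + c Z t
-1≤c-sum t = subst (-1ℤ ≤_) (sym (c-sum X t)) (-1≤total (up t))

-- The bounding hexagon of a polyiamond

module Isoperimetry (A : List Tile) (poly : IsPolyiamond A) (h : ℕ) (holes : HasHoles A h) where
  open Perimeter A poly h holes

  private
    bottom top : Axis → Tile
    bottom a = proj₁ (lowest a)
    top a = proj₁ (highest a)

    bottom∈ : ∀ a → bottom a ∈ A
    bottom∈ a = proj₁ (proj₂ (lowest a))

    top∈ : ∀ a → top a ∈ A
    top∈ a = proj₁ (proj₂ (highest a))

    -- Sides of the triangles that the extreme `Z` strips cut off the bounding parallelogram. The 1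
    -- in `u` is there because index sums reach down to -1 but only up to 0.
    l u : ℕ
    l = ∣ - hi Z - lo X - lo Y ∣
    u = ∣ lo Z + hi X + hi Y + 1ℤ ∣

  +l≡ : + l ≡ - hi Z - lo X - lo Y
  +l≡ = ℤ.0≤i⇒+∣i∣≡i (lem (lo≤ X (top∈ Z)) (lo≤ Y (top∈ Z)) (c-sum≤0 (top Z)))
    where
    lem : ∀ {lx ly x y z} → lx ≤ x → ly ≤ y → x + y + z ≤ 0ℤ → 0ℤ ≤ - z - lx - ly
    lem {lx} {ly} {x} {y} {z} p q r =
      certify (gap p ⊕ gap q ⊕ gap r) (solve (lx ∷ ly ∷ x ∷ y ∷ z ∷ []))

  +u≡ : + u ≡ lo Z + hi X + hi Y + 1ℤ
  +u≡ = ℤ.0≤i⇒+∣i∣≡i (lem (≤hi X (bottom∈ Z)) (≤hi Y (bottom∈ Z)) (-1≤c-sum (bottom Z)))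
    where
    lem : ∀ {hx hy x y z} → x ≤ hx → y ≤ hy → -1ℤ ≤ x + y + z → 0ℤ ≤ z + hx + hy + 1ℤ
    lem {hx} {hy} {x} {y} {z} p q r =
      certify (gap p ⊕ gap q ⊕ gap r) (solve (hx ∷ hy ∷ x ∷ y ∷ z ∷ []))

  +width≡ : ∀ a → + width a ≡ hi a + 1ℤ - lo a
  +width≡ a = trans (lem (lo a) (+ width a)) (cong (_- lo a) (lo+width a))
    where lem : ∀ l w → w ≡ l + w - l
          lem = solve-∀

  -- This and the next three bounds each evaluate the index sum, which is 0 or -1, at one extreme
  -- tile, and replace the two other indices by their extremes over `A`.
  l≤width-X : l ℕ.≤ width X
  l≤width-X = ℤ.drop‿+≤+ (subst₂ _≤_ (sym +l≡) (sym (+width≡ X))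
    (lem (≤hi X (bottom∈ Y)) (≤hi Z (bottom∈ Y)) (-1≤c-sum (bottom Y))))
    where
    lem : ∀ {hx hz lx x y z} → x ≤ hx → z ≤ hz → -1ℤ ≤ x + y + z → - hz - lx - y ≤ hx + 1ℤ - lx
    lem {hx} {hz} {lx} {x} {y} {z} p q r =
      certify (gap p ⊕ gap q ⊕ gap r) (solve (hx ∷ hz ∷ lx ∷ x ∷ y ∷ z ∷ []))

  l≤width-Y : l ℕ.≤ width Y
  l≤width-Y = ℤ.drop‿+≤+ (subst₂ _≤_ (sym +l≡) (sym (+width≡ Y))
    (lem (≤hi Y (bottom∈ X)) (≤hi Z (bottom∈ X)) (-1≤c-sum (bottom X))))
    where
    lem : ∀ {hy hz ly x y z} → y ≤ hy → z ≤ hz → -1ℤ ≤ x + y + z → - hz - x - ly ≤ hy + 1ℤ - ly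
    lem {hy} {hz} {ly} {x} {y} {z} p q r =
      certify (gap p ⊕ gap q ⊕ gap r) (solve (hy ∷ hz ∷ ly ∷ x ∷ y ∷ z ∷ []))

  u≤width-X : u ℕ.≤ width X
  u≤width-X = ℤ.drop‿+≤+ (subst₂ _≤_ (sym +u≡) (sym (+width≡ X))
    (lem (lo≤ X (top∈ Y)) (lo≤ Z (top∈ Y)) (c-sum≤0 (top Y))))
    where
    lem : ∀ {hx lx lz x y z} → lx ≤ x → lz ≤ z → x + y + z ≤ 0ℤ → lz + hx + y + 1ℤ ≤ hx + 1ℤ - lx
    lem {hx} {lx} {lz} {x} {y} {z} p q r =
      certify (gap p ⊕ gap q ⊕ gap r) (solve (hx ∷ lx ∷ lz ∷ x ∷ y ∷ z ∷ []))

  u≤width-Y : u ℕ.≤ width Y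
  u≤width-Y = ℤ.drop‿+≤+ (subst₂ _≤_ (sym +u≡) (sym (+width≡ Y))
    (lem (lo≤ Y (top∈ X)) (lo≤ Z (top∈ X)) (c-sum≤0 (top X))))
    where
    lem : ∀ {hy ly lz x y z} → ly ≤ y → lz ≤ z → x + y + z ≤ 0ℤ → lz + x + hy + 1ℤ ≤ hy + 1ℤ - ly
    lem {hy} {ly} {lz} {x} {y} {z} p q r =
      certify (gap p ⊕ gap q ⊕ gap r) (solve (hy ∷ ly ∷ lz ∷ x ∷ y ∷ z ∷ []))

  open Box (lo X) (lo Y) (width X) (width Y)

  tileOrHole-InBox : ∀ {t} → t ∈ tileOrHole → InBox t
  tileOrHole-InBox {t} p = inBox (tileOrHole-≥ X p) (below X) (tileOrHole-≥ Y p) (below Y)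
    where
    below : ∀ a → c a t + 1ℤ ≤ lo a + + width a
    below a = subst (c a t + 1ℤ ≤_) (sym (lo+width a)) (ℤ.+-monoˡ-≤ 1ℤ (tileOrHole-≤ a p))

  area-bound : length A ℕ.+ h ℕ.+ (l ℕ.* l ℕ.+ u ℕ.* u) ℕ.≤ width X ℕ.* (width Y ℕ.* 2)
  area-bound = subst (λ n → n ℕ.+ (l ℕ.* l ℕ.+ u ℕ.* u) ℕ.≤ width X ℕ.* (width Y ℕ.* 2)) length-tileOrHole
    (hexagon-count tileOrHole tileOrHole-unique tileOrHole-InBox
      (λ {t} p → subst (c Z t ≤_) hi-eq (tileOrHole-≤ Z p))
      (λ {t} p → subst (_≤ c Z t) lo-eq (tileOrHole-≥ Z p))
      l≤width-X l≤width-Y u≤width-X u≤width-Y)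
    where
    hi-eq : hi Z ≡ - (lo X + lo Y + + l)
    hi-eq = trans (lem (hi Z) (lo X) (lo Y)) (cong (λ e → - (lo X + lo Y + e)) (sym +l≡))
      where lem : ∀ hz lx ly → hz ≡ - (lx + ly + (- hz - lx - ly))
            lem = solve-∀
    lo-eq : lo Z ≡ 1ℤ - lo X - lo Y - + width X - + width Y + + u
    lo-eq = trans (lem (lo Z) (lo X) (lo Y) (hi X) (hi Y))
      (sym (cong₂ _+_ (cong₂ (λ e f → 1ℤ - lo X - lo Y - e - f) (+width≡ X) (+width≡ Y)) +u≡))
      where lem : ∀ lz lx ly hx hy → lz ≡ 1ℤ - lx - ly - (hx + 1ℤ - lx) - (hy + 1ℤ - ly) + (lz + hx + hy + 1ℤ)
            lem = solve-∀

  semiperimeter : ℕ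
  semiperimeter = width X ℕ.+ width Y ℕ.+ width Z

  isoperimetric-ineq : + 6 * (+ length A + + h) ≤ + semiperimeter * + semiperimeter
  isoperimetric-ineq = isoperimetric {+ length A + + h} {+ width X} {+ width Y} {+ l} {+ u} {+ width Z}
    (subst₂ _≤_
      (cong (λ e → + length A + + h + e) (cong₂ _+_ (ℤ.pos-* l l) (ℤ.pos-* u u)))
      (trans (ℤ.pos-* (width X) (width Y ℕ.* 2)) (cong (+ width X *_) (ℤ.pos-* (width Y) 2)))
      (+≤+ area-bound))
    (trans (+width≡ Z) (trans (lem (lo X) (lo Y) (lo Z) (hi X) (hi Y) (hi Z))
      (sym (cong₂ _-_ (cong₂ _-_ (cong₂ _+_ (+width≡ X) (+width≡ Y)) +l≡) +u≡))))
    where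
    lem : ∀ lx ly lz hx hy hz → hz + 1ℤ - lz ≡
          (hx + 1ℤ - lx) + (hy + 1ℤ - ly) - (- hz - lx - ly) - (lz + hx + hy + 1ℤ)
    lem = solve-∀

  3≤semiperimeter : 3 ℕ.≤ semiperimeter
  3≤semiperimeter = ℕ.+-mono-≤ (ℕ.+-mono-≤ (s≤s (z≤n {∣ hi X - lo X ∣})) (s≤s (z≤n {∣ hi Y - lo Y ∣})))
                               (s≤s (z≤n {∣ hi Z - lo Z ∣}))

-- The real inequality behind the lower bound: with p = n + 2 - 3h ≥ w it reads
-- p² ≥ 6p - 12 + 36k² - 36k, which forces p ≥ 6k.
quadratic-bound : ∀ {n t k w} → + 2 ≤ k → + 2 * t + k ≡ k * k → + 3 ≤ w →
                  + 9 * t + w ≤ n + + 2 → + 6 * (n + + 3 * t) ≤ w * w →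
                  ¬ (n + + 3 ≤ + 9 * t + + 6 * k)
quadratic-bound {n} {t} {k} {w} k≥2 t-eq w≥3 area iso n< =
  -- With p = n + 2 - 9t, the second term is p² - w² and the last one (6k - 4)² - (p - 3)², both
  -- factored so that each factor is visibly nonnegative. The total is -5 because (6k - 3)² - 12 -
  -- (6k - 4)² = 12(k - 2) + 5.
  absurd-by
    (gap iso
      ⊕ 0≤i*j (gap area) (gap area ⊕ gap w≥3 ⊕ gap w≥3 ⊕ 0≤+ 6)
      ⊕ 0≤i*j (0≤+ 36) (gap (ℤ.≤-reflexive (sym t-eq)))
      ⊕ 0≤i*j (0≤+ 12) (gap k≥2)
      ⊕ 0≤i*j (gap n<) (0≤i*j (0≤+ 6) (gap k≥2) ⊕ 0≤+ 8 ⊕ gap area ⊕ gap w≥3))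
    (lem n t k w)
  where
  0≤+ : ∀ m → 0ℤ ≤ + m
  0≤+ m = +≤+ z≤n
  lem : ∀ n t k w →
    w * w - + 6 * (n + + 3 * t)
      + (n + + 2 - (+ 9 * t + w)) * (n + + 2 - (+ 9 * t + w) + (w - + 3) + (w - + 3) + + 6)
      + + 36 * (+ 2 * t + k - k * k)
      + + 12 * (k - + 2)
      + (+ 9 * t + + 6 * k - (n + + 3)) * (+ 6 * (k - + 2) + + 8 + (n + + 2 - (+ 9 * t + w)) + (w - + 3))
    ≡ -[1+ 4 ]
  lem = solve-∀

lower-bound : ∀ k → 2 ℕ.≤ k → ∀ A → IsPolyiamond A → HasHoles A (hk k) → nk k ℕ.≤ length A
lower-bound k k≥2 A poly holes = subst (ℕ._≤ n) (sym (nk≡ k))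
  (ℕ.m≤n+o⇒m∸n≤o (9 ℕ.* t ℕ.+ 6 ℕ.* k) 2 (subst (9 ℕ.* t ℕ.+ 6 ℕ.* k ℕ.≤_) (ℕ.+-comm n 2) (ℕ.≮⇒≥ small)))
  where
  n = length A
  t = triangular k
  open Isoperimetry A poly (hk k) holes
  open Perimeter A poly (hk k) holes using (perimeter-bound)
  w = semiperimeter

  push : ∀ a b c d → + (a ℕ.* b ℕ.+ c ℕ.* d) ≡ + a * + b + + c * + d
  push a b c d = cong₂ _+_ (ℤ.pos-* a b) (ℤ.pos-* c d)

  t-eq : + 2 * + t + + k ≡ + k * + k
  t-eq = trans (cong (_+ + k) (sym (ℤ.pos-* 2 t))) (trans (cong +_ (2*triangular k)) (ℤ.pos-* k k))

  9t : 3 ℕ.* hk k ≡ 9 ℕ.* t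
  9t = trans (cong (3 ℕ.*_) (hk≡ k)) (lem t)
    where lem : ∀ t → 3 ℕ.* (3 ℕ.* t) ≡ 9 ℕ.* t
          lem = solveℕ-∀

  area : + 9 * + t + + w ≤ + n + + 2
  area = subst (_≤ + n + + 2) (cong (_+ + w) (trans (cong +_ 9t) (ℤ.pos-* 9 t))) (+≤+ perimeter-bound)

  iso : + 6 * (+ n + + 3 * + t) ≤ + w * + w
  iso = subst (λ e → + 6 * (+ n + e) ≤ + w * + w) (trans (cong +_ (hk≡ k)) (ℤ.pos-* 3 t)) isoperimetric-ineq

  small : ¬ (n ℕ.+ 2 ℕ.< 9 ℕ.* t ℕ.+ 6 ℕ.* k)
  small lt = quadratic-bound {+ n} {+ t} {+ k} {+ w} (+≤+ k≥2) t-eq (+≤+ 3≤semiperimeter) area iso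
    (subst₂ _≤_ (cong +_ (sym (ℕ.+-suc n 2))) (push 9 t 6 k) (+≤+ lt))

-- The extremal polyiamonds

evenℕ : ℕ → Bool
evenℕ zero = true
evenℕ (suc n) = not (evenℕ n)

even : ℤ → Bool
even z = evenℕ ∣ z ∣

even-suc : ∀ z → even (z + 1ℤ) ≡ not (even z)
even-suc (+ n) = cong evenℕ (ℕ.+-comm n 1)
even-suc -[1+ zero ] = refl
even-suc -[1+ suc n ] = sym (Bool.not-involutive _)

even-pred : ∀ z → even (z - 1ℤ) ≡ not (even z)
even-pred z = trans (sym (Bool.not-involutive _))
  (cong not (trans (sym (even-suc (z - 1ℤ))) (cong even (-1+1 z))))

even-neg : ∀ z → even (- z) ≡ even z
even-neg z = cong evenℕ (ℤ.∣-i∣≡∣i∣ z)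

1≤⊎≤0 : ∀ z → (1ℤ ≤ z) ⊎ (z ≤ 0ℤ)
1≤⊎≤0 (+ zero) = inj₂ ℤ.≤-refl
1≤⊎≤0 (+ suc n) = inj₁ (+≤+ (s≤s z≤n))
1≤⊎≤0 -[1+ n ] = inj₂ -≤+

0≤⊎<0 : ∀ z → (0ℤ ≤ z) ⊎ (z + 1ℤ ≤ 0ℤ)
0≤⊎<0 (+ n) = inj₁ (+≤+ z≤n)
0≤⊎<0 -[1+ zero ] = inj₂ ℤ.≤-refl
0≤⊎<0 -[1+ suc n ] = inj₂ -≤+

1≤⇒≰0 : ∀ {z} → 1ℤ ≤ z → z ≤ 0ℤ → ⊥
1≤⇒≰0 p q with +≤+ () ← ℤ.≤-trans p q

0≤⇒0⊎1≤ : ∀ {z} → 0ℤ ≤ z → (z ≡ 0ℤ) ⊎ (1ℤ ≤ z)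
0≤⇒0⊎1≤ {+ zero} _ = inj₁ refl
0≤⇒0⊎1≤ {+ suc n} _ = inj₂ (+≤+ (s≤s z≤n))

odd⇒1≤ : ∀ {z} → 0ℤ ≤ z → even z ≡ false → 1ℤ ≤ z
odd⇒1≤ {+ zero} _ ()
odd⇒1≤ {+ suc n} _ _ = +≤+ (s≤s z≤n)

-- The punctured tiles: in every ring around the central tile, every second one
-- of the tiles sharing an edge with the previous ring.
H : Bool → ℤ → ℤ → ℤ → Set
H true x y z = 1ℤ ≤ x × y ≤ 0ℤ × z ≤ 0ℤ × even y ≡ true
H false x y z = 1ℤ ≤ x × 1ℤ ≤ z × even x ≡ true

H? : ∀ b x y z → Dec (H b x y z)
H? true x y z = 1ℤ ℤ.≤? x ×-dec y ℤ.≤? 0ℤ ×-dec z ℤ.≤? 0ℤ ×-dec even y Bool.≟ true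
H? false x y z = 1ℤ ℤ.≤? x ×-dec 1ℤ ℤ.≤? z ×-dec even x Bool.≟ true

HoleAt : Axis → Tile → Set
HoleAt s t = H (up t) (c s t) (c (σ s) t) (c (σ (σ s)) t)

Hole : Tile → Set
Hole t = ∃ λ s → HoleAt s t

∃Axis? : {P : Axis → Set} → (∀ a → Dec (P a)) → Dec (∃ P)
∃Axis? P? with P? X | P? Y | P? Z
... | yes p | _ | _ = yes (X , p)
... | no _ | yes p | _ = yes (Y , p)
... | no _ | no _ | yes p = yes (Z , p)
... | no ¬x | no ¬y | no ¬z = no λ { (X , p) → ¬x p ; (Y , p) → ¬y p ; (Z , p) → ¬z p }

∀Axis? : {P : Axis → Set} → (∀ a → Dec (P a)) → Dec (∀ a → P a)
∀Axis? P? = map′ (λ { (x , y , z) X → x ; (x , y , z) Y → y ; (x , y , z) Z → z })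
                 (λ p → p X , p Y , p Z) (P? X ×-dec P? Y ×-dec P? Z)

Hole? : ∀ t → Dec (Hole t)
Hole? t = ∃Axis? λ s → H? (up t) (c s t) (c (σ s) t) (c (σ (σ s)) t)

Within : ℤ → ℤ → Set
Within κ x = - κ ≤ x × x + 1ℤ ≤ κ

-- The hexagon with sides alternately κ + 1 and κ - 1.
Hex : ℤ → Tile → Set
Hex κ t = ∀ a → Within κ (c a t)

Hex? : ∀ κ t → Dec (Hex κ t)
Hex? κ t = ∀Axis? λ a → - κ ℤ.≤? c a t ×-dec c a t + 1ℤ ℤ.≤? κ

Region : ℤ → Tile → Set
Region κ t = Hex κ t × ¬ Hole t

Region? : ∀ κ t → Dec (Region κ t)
Region? κ t = Hex? κ t ×-dec ¬? (Hole? t)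

-- Coordinates seen from axis s, so that arguments can be made for one of the
-- three rotated copies at a time.
record At (s : Axis) (t : Tile) (β : Bool) (x y z : ℤ) : Set where
  constructor at
  field
    up≡ : up t ≡ β
    x≡ : c s t ≡ x
    y≡ : c (σ s) t ≡ y
    z≡ : c (σ (σ s)) t ≡ z

At⇒H : ∀ {s t β x y z} → At s t β x y z → HoleAt s t → H β x y z
At⇒H (at refl refl refl refl) h = h

rotate : ∀ {s t β x y z} → At s t β x y z → At (σ s) t β y z x
rotate {s} {t} (at u≡ x≡ y≡ z≡) = at u≡ y≡ z≡ (trans (cong (λ a → c a t) (σ³ s)) x≡)

module _ {s t β x y z} (p : At s t β x y z) where
  open At p

  sum≡ : x + y + z ≡ total β
  sum≡ = trans (sym (cong₂ _+_ (cong₂ _+_ x≡ y≡) z≡)) (trans (c-sum s t) (cong total up≡))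

  step₁ : At s (nb s t) (not β) (x + sgn β) y z
  step₁ = at (trans (up-nb s t) (cong not up≡))
    (trans (c-nb s t) (cong₂ _+_ x≡ (cong sgn up≡)))
    (trans (c-nb-σ s t) y≡) (trans (c-nb-σσ s t) z≡)

  step₂ : At s (nb (σ s) t) (not β) x (y + sgn β) z
  step₂ = at (trans (up-nb (σ s) t) (cong not up≡))
    (trans (c-nb-σ′ s t) x≡)
    (trans (c-nb (σ s) t) (cong₂ _+_ y≡ (cong sgn up≡)))
    (trans (c-nb-σ (σ s) t) z≡)

  step₃ : At s (nb (σ (σ s)) t) (not β) x y (z + sgn β)
  step₃ = at (trans (up-nb (σ (σ s)) t) (cong not up≡))
    (trans (c-nb-σσ′ s t) x≡)
    (trans (c-nb-σ′ (σ s) t) y≡)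
    (trans (c-nb (σ (σ s)) t) (cong₂ _+_ z≡ (cong sgn up≡)))

  hex : ∀ {κ} → Within κ x → Within κ y → Within κ z → Hex κ t
  hex wx wy wz a with orbit s a
  ... | inj₁ refl = subst (Within _) (sym x≡) wx
  ... | inj₂ (inj₁ refl) = subst (Within _) (sym y≡) wy
  ... | inj₂ (inj₂ refl) = subst (Within _) (sym z≡) wz

  solid : ¬ H β x y z → ¬ H β y z x → ¬ H β z x y → ¬ Hole t
  solid ¬h₁ ¬h₂ ¬h₃ (a , h) with orbit s a
  ... | inj₁ refl = ¬h₁ (At⇒H p h)
  ... | inj₂ (inj₁ refl) = ¬h₂ (At⇒H (rotate p) h)
  ... | inj₂ (inj₂ refl) = ¬h₃ (At⇒H (rotate (rotate p)) h)

here-at : ∀ s t → At s t (up t) (c s t) (c (σ s) t) (c (σ (σ s)) t)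
here-at s t = at refl refl refl refl

Path-map : ∀ {P Q : Tile → Set} → (∀ {t} → P t → Q t) → ∀ {t u} → Path P t u → Path Q t u
Path-map f (here p) = here (f p)
Path-map f (step p adj q) = step (f p) adj (Path-map f q)

0≤+ : ∀ n → 0ℤ ≤ + n
0≤+ n = +≤+ z≤n

gap₌ : ∀ {a b} → a ≡ b → 0ℤ ≤ b - a
gap₌ = gap ∘ ℤ.≤-reflexive

1≤+1 : ∀ {x} → 0ℤ ≤ x → 1ℤ ≤ x + 1ℤ
1≤+1 {x} p = certify p (solve (x ∷ []))

≤0⇒-1≤0 : ∀ {x} → x ≤ 0ℤ → x - 1ℤ ≤ 0ℤ
≤0⇒-1≤0 {x} p = certify (gap p ⊕ 0≤+ 1) (solve (x ∷ []))

<0⇒≤0 : ∀ {x} → x + 1ℤ ≤ 0ℤ → x ≤ 0ℤ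
<0⇒≤0 {x} p = certify (gap p ⊕ 0≤+ 1) (solve (x ∷ []))

1≤⇒0≤ : ∀ {x} → 1ℤ ≤ x → 0ℤ ≤ x
1≤⇒0≤ = ℤ.≤-trans (+≤+ z≤n)

up-sum : ∀ {s t x y z} → At s t true x y z → x + y + z ≡ 0ℤ
up-sum = sum≡

down-sum : ∀ {s t x y z} → At s t false x y z → x + y + z ≡ -1ℤ
down-sum = sum≡

-- Tiles of the hexagon by sector

module _ {s t x y z} (p : At s t true x y z) where
  private
    e : x + y + z ≡ 0ℤ
    e = up-sum p

  -- Names with ⁺ refer to the sectors where y and z are at most 0, names with ⁻ to those where x
  -- and z are nonnegative. In a sector one bound, on x or on y respectively, decides membership in
  -- the hexagon; the other five follow from the index sum.
  hex-up⁺ : ∀ {κ} → 1ℤ ≤ κ → 1ℤ ≤ x → y ≤ 0ℤ → z ≤ 0ℤ → x + 1ℤ ≤ κ → Hex κ t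
  hex-up⁺ {κ} k≥1 x≥1 y≤0 z≤0 x<κ = hex p {κ}
    (certify (gap x≥1 ⊕ gap k≥1 ⊕ 0≤+ 2) (solve (x ∷ κ ∷ [])) , x<κ)
    (certify (gap x<κ ⊕ 0≤+ 1 ⊕ gap z≤0 ⊕ gap₌ (sym e)) (solve (x ∷ y ∷ z ∷ κ ∷ []))
      , certify (gap k≥1 ⊕ gap y≤0) (solve (y ∷ κ ∷ [])))
    (certify (gap x<κ ⊕ 0≤+ 1 ⊕ gap y≤0 ⊕ gap₌ (sym e)) (solve (x ∷ y ∷ z ∷ κ ∷ []))
      , certify (gap k≥1 ⊕ gap z≤0) (solve (z ∷ κ ∷ [])))

  hex-up⁻ : ∀ {κ} → 1ℤ ≤ κ → 1ℤ ≤ x → 1ℤ ≤ z → - κ ≤ y → Hex κ t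
  hex-up⁻ {κ} k≥1 x≥1 z≥1 y≥ = hex p {κ}
    (certify (gap x≥1 ⊕ gap k≥1 ⊕ 0≤+ 2) (solve (x ∷ κ ∷ []))
      , certify (gap y≥ ⊕ gap z≥1 ⊕ gap₌ e) (solve (x ∷ y ∷ z ∷ κ ∷ [])))
    (y≥ , certify (gap k≥1 ⊕ gap x≥1 ⊕ gap z≥1 ⊕ 0≤+ 2 ⊕ gap₌ e) (solve (x ∷ y ∷ z ∷ κ ∷ [])))
    (certify (gap z≥1 ⊕ gap k≥1 ⊕ 0≤+ 2) (solve (z ∷ κ ∷ []))
      , certify (gap y≥ ⊕ gap x≥1 ⊕ gap₌ e) (solve (x ∷ y ∷ z ∷ κ ∷ [])))

  solid-up⁺ : y ≤ 0ℤ → z ≤ 0ℤ → even y ≡ false → ¬ Hole t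
  solid-up⁺ y≤0 z≤0 odd = solid p
    (λ { (_ , _ , _ , ev) → contradiction (trans (sym odd) ev) λ () })
    (λ { (y≥1 , _) → 1≤⇒≰0 y≥1 y≤0 })
    (λ { (z≥1 , _) → 1≤⇒≰0 z≥1 z≤0 })

  solid-up⁻ : 1ℤ ≤ x → 1ℤ ≤ z → ¬ Hole t
  solid-up⁻ x≥1 z≥1 = solid p
    (λ { (_ , _ , z≤0 , _) → 1≤⇒≰0 z≥1 z≤0 })
    (λ { (_ , z≤0 , _) → 1≤⇒≰0 z≥1 z≤0 })
    (λ { (_ , x≤0 , _) → 1≤⇒≰0 x≥1 x≤0 })

module _ {s t x y z} (p : At s t false x y z) where
  private
    e : x + y + z ≡ -1ℤ
    e = down-sum p

  hex-down⁺ : ∀ {κ} → 1ℤ ≤ κ → 0ℤ ≤ x → y ≤ 0ℤ → z ≤ 0ℤ → x + 1ℤ ≤ κ → Hex κ t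
  hex-down⁺ {κ} k≥1 x≥0 y≤0 z≤0 x<κ = hex p {κ}
    (certify (x≥0 ⊕ gap k≥1 ⊕ 0≤+ 1) (solve (x ∷ κ ∷ [])) , x<κ)
    (certify (gap x<κ ⊕ gap z≤0 ⊕ gap₌ (sym e)) (solve (x ∷ y ∷ z ∷ κ ∷ []))
      , certify (gap k≥1 ⊕ gap y≤0) (solve (y ∷ κ ∷ [])))
    (certify (gap x<κ ⊕ gap y≤0 ⊕ gap₌ (sym e)) (solve (x ∷ y ∷ z ∷ κ ∷ []))
      , certify (gap k≥1 ⊕ gap z≤0) (solve (z ∷ κ ∷ [])))

  hex-down⁻ : ∀ {κ} → 1ℤ ≤ κ → 0ℤ ≤ x → 0ℤ ≤ z → - κ ≤ y → Hex κ t
  hex-down⁻ {κ} k≥1 x≥0 z≥0 y≥ = hex p {κ}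
    (certify (x≥0 ⊕ gap k≥1 ⊕ 0≤+ 1) (solve (x ∷ κ ∷ []))
      , certify (gap y≥ ⊕ z≥0 ⊕ gap₌ e) (solve (x ∷ y ∷ z ∷ κ ∷ [])))
    (y≥ , certify (gap k≥1 ⊕ x≥0 ⊕ z≥0 ⊕ gap₌ e ⊕ 0≤+ 1) (solve (x ∷ y ∷ z ∷ κ ∷ [])))
    (certify (z≥0 ⊕ gap k≥1 ⊕ 0≤+ 1) (solve (z ∷ κ ∷ []))
      , certify (gap y≥ ⊕ x≥0 ⊕ gap₌ e) (solve (x ∷ y ∷ z ∷ κ ∷ [])))

  down⁻-y≤0 : 0ℤ ≤ x → 0ℤ ≤ z → y ≤ 0ℤ
  down⁻-y≤0 x≥0 z≥0 = certify (x≥0 ⊕ z≥0 ⊕ gap₌ e ⊕ 0≤+ 1) (solve (x ∷ y ∷ z ∷ []))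

  solid-down⁺ : y ≤ 0ℤ → z ≤ 0ℤ → ¬ Hole t
  solid-down⁺ y≤0 z≤0 = solid p
    (λ { (_ , z≥1 , _) → 1≤⇒≰0 z≥1 z≤0 })
    (λ { (y≥1 , _) → 1≤⇒≰0 y≥1 y≤0 })
    (λ { (z≥1 , _) → 1≤⇒≰0 z≥1 z≤0 })

  solid-down⁻ : 0ℤ ≤ x → 0ℤ ≤ z → even x ≡ false → ¬ Hole t
  solid-down⁻ x≥0 z≥0 odd = solid p
    (λ { (_ , _ , ev) → contradiction (trans (sym odd) ev) λ () })
    (λ { (y≥1 , _) → 1≤⇒≰0 y≥1 (down⁻-y≤0 x≥0 z≥0) })
    (λ { (_ , y≥1 , _) → 1≤⇒≰0 y≥1 (down⁻-y≤0 x≥0 z≥0) })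

Region-widen : ∀ {κ t} → Region κ t → Region (κ + 1ℤ) t
Region-widen {κ} {t} (h , ¬o) = (λ a → certify (gap (proj₁ (h a)) ⊕ 0≤+ 1) (lem (c a t) κ)
                                     , ℤ.≤-trans (proj₂ (h a)) (ℤ.i≤i+j κ 1ℤ)) , ¬o
  where lem : ∀ x κ → x - - (κ + 1ℤ) ≡ x - - κ + 1ℤ
        lem = solve-∀

-- The parity rules choosing the holes leave every remaining tile of ring κ + 1
-- a way into ring κ, after at most three sideways steps.
module Inward (κ : ℤ) (k≥1 : 1ℤ ≤ κ) where

  Inner : Tile → Set
  Inner t = ∃ λ u → Path (Region (κ + 1ℤ)) t u × Region κ u

  private
    k+1≥1 : 1ℤ ≤ κ + 1ℤ
    k+1≥1 = 1≤+1 (1≤⇒0≤ k≥1)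

  arrive : ∀ a {t} → Region (κ + 1ℤ) t → Region κ (nb a t) → Inner t
  arrive a {t} r q = nb a t , Path-nb a r (Region-widen q) , q

  via : ∀ a {t} → Region (κ + 1ℤ) t → Inner (nb a t) → Inner t
  via a {t} r (u , p , q) = u , step r (nb-Adj a t) p , q

  module _ {s t x y z} (p : At s t true x y z) where
    inward-up⁺ : 1ℤ ≤ x → y ≤ 0ℤ → z ≤ 0ℤ → even y ≡ false → x + 1ℤ ≤ κ + 1ℤ → Inner t
    inward-up⁺ x≥1 y≤0 z≤0 odd x≤κ = arrive s
      (hex-up⁺ p k+1≥1 x≥1 y≤0 z≤0 x≤κ , solid-up⁺ p y≤0 z≤0 odd)
      (hex-down⁺ p′ k≥1 (gap x≥1) y≤0 z≤0 (certify (gap x≤κ) (solve (x ∷ κ ∷ []))) , solid-down⁺ p′ y≤0 z≤0)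
      where
      p′ : At s (nb s t) false (x - 1ℤ) y z
      p′ = step₁ p

  module _ {s t x y z} (p : At s t false x y z) where
    private
      e = down-sum p

    inward-down⁻ : 1ℤ ≤ x → 1ℤ ≤ z → even x ≡ false → - (κ + 1ℤ) ≤ y → Inner t
    inward-down⁻ x≥1 z≥1 odd y≥ = arrive (σ s)
      (hex-down⁻ p k+1≥1 (1≤⇒0≤ x≥1) (1≤⇒0≤ z≥1) y≥ , solid-down⁻ p (1≤⇒0≤ x≥1) (1≤⇒0≤ z≥1) odd)
      (hex-up⁻ p′ k≥1 x≥1 z≥1 (certify (gap y≥) (solve (y ∷ κ ∷ []))) , solid-up⁻ p′ x≥1 z≥1)
      where
      p′ : At s (nb (σ s) t) true x (y + 1ℤ) z
      p′ = step₂ p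

    -- At z = 0 a down tile has no edge towards the inner ring. Its neighbour across axis `σ s`
    -- starts the adjacent side of the ring and has second index -x, which is odd, so it is no hole.
    inward-edge : 1ℤ ≤ x → z ≡ 0ℤ → even x ≡ false → - (κ + 1ℤ) ≤ y → Inner t
    inward-edge x≥1 refl odd y≥ = via (σ s)
      (hex-down⁻ p k+1≥1 (1≤⇒0≤ x≥1) ℤ.≤-refl y≥ , solid-down⁻ p (1≤⇒0≤ x≥1) ℤ.≤-refl odd)
      (inward-up⁺ p′ x≥1
        (certify (gap x≥1 ⊕ gap₌ e ⊕ 0≤+ 1) (solve (x ∷ y ∷ []))) ℤ.≤-refl
        (trans (cong even y+1≡) (trans (even-neg x) odd))
        (certify (gap y≥ ⊕ gap₌ e) (solve (x ∷ y ∷ κ ∷ []))))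
      where
      p′ : At s (nb (σ s) t) true x (y + 1ℤ) 0ℤ
      p′ = step₂ p
      y+1≡ : y + 1ℤ ≡ - x
      y+1≡ = trans (lem x y) (trans (cong (λ v → v + 1ℤ - x) e) (ℤ.+-identityˡ (- x)))
        where lem : ∀ x y → y + 1ℤ ≡ x + y + 0ℤ + 1ℤ - x
              lem = solve-∀

  module _ {s t x y z} (p : At s t true x y z) where
    -- The two sideways neighbours have first indices x - 1 and x. One of these is odd, so that
    -- neighbour is not a hole and leads inward, around the corner if it has z = 0.
    inward-up⁻ : 1ℤ ≤ x → 1ℤ ≤ z → - (κ + 1ℤ) ≤ y → Inner t
    inward-up⁻ x≥1 z≥1 y≥ with even x in parity
    ... | true = via s r (inward-down⁻ p′
        (odd⇒1≤ (gap x≥1) odd) z≥1 odd y≥)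
      where
      r : Region (κ + 1ℤ) t
      r = hex-up⁻ p k+1≥1 x≥1 z≥1 y≥ , solid-up⁻ p x≥1 z≥1
      p′ : At s (nb s t) false (x - 1ℤ) y z
      p′ = step₁ p
      odd : even (x - 1ℤ) ≡ false
      odd = trans (even-pred x) (cong not parity)
    ... | false = via (σ (σ s)) r (Sum.[ (λ z-1≡0 → inward-edge p′ x≥1 z-1≡0 parity y≥)
                                      , (λ z-1≥1 → inward-down⁻ p′ x≥1 z-1≥1 parity y≥) ]
                                      (0≤⇒0⊎1≤ (gap z≥1)))
      where
      r : Region (κ + 1ℤ) t
      r = hex-up⁻ p k+1≥1 x≥1 z≥1 y≥ , solid-up⁻ p x≥1 z≥1
      p′ : At s (nb (σ (σ s)) t) false x y (z - 1ℤ)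
      p′ = step₃ p

  module _ {s t x y z} (p : At s t false x y z) where
    private
      e = down-sum p

    -- The two sideways neighbours have second indices y + 1 and y, one of which is odd.
    inward-down⁺ : y + 1ℤ ≤ 0ℤ → z + 1ℤ ≤ 0ℤ → x + 1ℤ ≤ κ + 1ℤ → Inner t
    inward-down⁺ y<0 z<0 x≤κ with even y in parity
    ... | true = via (σ s) r (inward-up⁺ p′ x≥1 y<0 z≤0 (trans (even-suc y) (cong not parity)) x≤κ)
      where
      y≤0 = <0⇒≤0 y<0
      z≤0 = <0⇒≤0 z<0
      x≥1 : 1ℤ ≤ x
      x≥1 = certify (gap y<0 ⊕ gap z<0 ⊕ gap₌ (sym e)) (solve (x ∷ y ∷ z ∷ []))
      r : Region (κ + 1ℤ) t
      r = hex-down⁺ p k+1≥1 (1≤⇒0≤ x≥1) y≤0 z≤0 x≤κ , solid-down⁺ p y≤0 z≤0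
      p′ : At s (nb (σ s) t) true x (y + 1ℤ) z
      p′ = step₂ p
    ... | false = via (σ (σ s)) r (inward-up⁺ p′ x≥1 y≤0 z<0 parity x≤κ)
      where
      y≤0 = <0⇒≤0 y<0
      z≤0 = <0⇒≤0 z<0
      x≥1 : 1ℤ ≤ x
      x≥1 = certify (gap y<0 ⊕ gap z<0 ⊕ gap₌ (sym e)) (solve (x ∷ y ∷ z ∷ []))
      r : Region (κ + 1ℤ) t
      r = hex-down⁺ p k+1≥1 (1≤⇒0≤ x≥1) y≤0 z≤0 x≤κ , solid-down⁺ p y≤0 z≤0
      p′ : At s (nb (σ (σ s)) t) true x y (z + 1ℤ)
      p′ = step₃ p

    -- Here x may be even, and then the neighbour with second index -x is a hole. The way therefore
    -- goes through the up tile at z = 1, where `inward-up⁻` sorts out the parity.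
    inward-edge₀ : 1ℤ ≤ x → z ≡ 0ℤ → - (κ + 1ℤ) ≤ y → Inner t
    inward-edge₀ x≥1 refl y≥ = via (σ (σ s))
      (hex-down⁻ p k+1≥1 (1≤⇒0≤ x≥1) ℤ.≤-refl y≥
        , solid-down⁺ p (down⁻-y≤0 p (1≤⇒0≤ x≥1) ℤ.≤-refl) ℤ.≤-refl)
      (inward-up⁻ p′ x≥1 ℤ.≤-refl y≥)
      where
      p′ : At s (nb (σ (σ s)) t) true x y 1ℤ
      p′ = step₃ p

    inward-edge₁ : x ≡ 0ℤ → 1ℤ ≤ z → - (κ + 1ℤ) ≤ y → Inner t
    inward-edge₁ refl z≥1 y≥ = via s
      (hex-down⁻ p k+1≥1 ℤ.≤-refl (1≤⇒0≤ z≥1) y≥ , solid p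
        (λ { (x≥1 , _) → 1≤⇒≰0 x≥1 ℤ.≤-refl })
        (λ { (y≥1 , _) → 1≤⇒≰0 y≥1 y≤0 })
        (λ { (_ , y≥1 , _) → 1≤⇒≰0 y≥1 y≤0 }))
      (inward-up⁻ p′ ℤ.≤-refl z≥1 y≥)
      where
      y≤0 = down⁻-y≤0 p ℤ.≤-refl (1≤⇒0≤ z≥1)
      p′ : At s (nb s t) true 1ℤ y z
      p′ = step₁ p

    -- Now y = -1: a neighbour of the central tile, which is already inside.
    inward-tip : x ≡ 0ℤ → z ≡ 0ℤ → Inner t
    inward-tip refl refl = t , here (Region-widen r) , r
      where
      y≤0 = down⁻-y≤0 p ℤ.≤-refl ℤ.≤-refl
      r : Region κ t
      r = hex-down⁺ p k≥1 ℤ.≤-refl y≤0 ℤ.≤-refl k≥1 , solid-down⁺ p y≤0 ℤ.≤-refl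

    inward-down-sector : 0ℤ ≤ x → 0ℤ ≤ z → - (κ + 1ℤ) ≤ y → ¬ H false x y z → Inner t
    inward-down-sector x≥0 z≥0 y≥ ¬h with 0≤⇒0⊎1≤ x≥0 | 0≤⇒0⊎1≤ z≥0
    ... | inj₁ x≡0 | inj₁ z≡0 = inward-tip x≡0 z≡0
    ... | inj₁ x≡0 | inj₂ z≥1 = inward-edge₁ x≡0 z≥1 y≥
    ... | inj₂ x≥1 | inj₁ z≡0 = inward-edge₀ x≥1 z≡0 y≥
    ... | inj₂ x≥1 | inj₂ z≥1 = inward-down⁻ p x≥1 z≥1 (Bool.¬-not λ ev → ¬h (x≥1 , z≥1 , ev)) y≥

  inward : ∀ t → Region (κ + 1ℤ) t → Inner t
  inward t (h , ¬o) = byOrientation (up t) refl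
    where
    seen : ∀ {β} s → up t ≡ β → At s t β (c s t) (c (σ s) t) (c (σ (σ s)) t)
    seen s eq = at eq refl refl refl

    hole : ∀ {β} s → up t ≡ β → H β (c s t) (c (σ s) t) (c (σ (σ s)) t) → Hole t
    hole s refl h = s , h

    fromUp⁺ : ∀ s → up t ≡ true → 1ℤ ≤ c s t → c (σ s) t ≤ 0ℤ → c (σ (σ s)) t ≤ 0ℤ → Inner t
    fromUp⁺ s eq x≥1 y≤0 z≤0 = inward-up⁺ (seen s eq) x≥1 y≤0 z≤0
      (Bool.¬-not λ ev → ¬o (hole s eq (x≥1 , y≤0 , z≤0 , ev))) (proj₂ (h s))

    fromUp⁻ : ∀ s → up t ≡ true → 1ℤ ≤ c s t → 1ℤ ≤ c (σ (σ s)) t → Inner t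
    fromUp⁻ s eq x≥1 z≥1 = inward-up⁻ (seen s eq) x≥1 z≥1 (proj₁ (h (σ s)))

    fromDown⁻ : ∀ s → up t ≡ false → 0ℤ ≤ c s t → 0ℤ ≤ c (σ (σ s)) t → Inner t
    fromDown⁻ s eq x≥0 z≥0 = inward-down-sector (seen s eq) x≥0 z≥0 (proj₁ (h (σ s)))
      (¬o ∘ hole s eq)

    fromDown⁺ : ∀ s → up t ≡ false → c (σ s) t + 1ℤ ≤ 0ℤ → c (σ (σ s)) t + 1ℤ ≤ 0ℤ → Inner t
    fromDown⁺ s eq y<0 z<0 = inward-down⁺ (seen s eq) y<0 z<0 (proj₂ (h s))

    central : (∀ a → c a t ≤ 0ℤ) → up t ≡ true → Inner t
    central ≤0 eq = t , here (h , ¬o) , (λ a → lower a , upper a) , ¬o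
      where
      bound : ∀ {x y z} → x + y + z ≡ 0ℤ → y ≤ 0ℤ → z ≤ 0ℤ → - κ ≤ x
      bound {x} {y} {z} e y≤0 z≤0 = certify (gap y≤0 ⊕ gap z≤0 ⊕ gap k≥1 ⊕ 0≤+ 1 ⊕ gap₌ (sym e))
        (solve (x ∷ y ∷ z ∷ κ ∷ []))
      lower : ∀ a → - κ ≤ c a t
      lower a = bound (up-sum (seen a eq)) (≤0 (σ a)) (≤0 (σ (σ a)))
      upper : ∀ a → c a t + 1ℤ ≤ κ
      upper a = ℤ.≤-trans (ℤ.+-monoˡ-≤ 1ℤ (≤0 a)) k≥1

    byOrientation : ∀ β → up t ≡ β → Inner t
    byOrientation true eq with 1≤⊎≤0 (c X t) | 1≤⊎≤0 (c Y t) | 1≤⊎≤0 (c Z t)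
    ... | inj₁ x | _ | inj₁ z = fromUp⁻ X eq x z
    ... | inj₁ x | inj₁ y | inj₂ _ = fromUp⁻ Y eq y x
    ... | inj₂ _ | inj₁ y | inj₁ z = fromUp⁻ Z eq z y
    ... | inj₁ x | inj₂ y | inj₂ z = fromUp⁺ X eq x y z
    ... | inj₂ x | inj₁ y | inj₂ z = fromUp⁺ Y eq y z x
    ... | inj₂ x | inj₂ y | inj₁ z = fromUp⁺ Z eq z x y
    ... | inj₂ x | inj₂ y | inj₂ z = central (λ { X → x ; Y → y ; Z → z }) eq
    byOrientation false eq with 0≤⊎<0 (c X t) | 0≤⊎<0 (c Y t) | 0≤⊎<0 (c Z t)
    ... | inj₁ x | _ | inj₁ z = fromDown⁻ X eq x z
    ... | inj₁ x | inj₁ y | inj₂ _ = fromDown⁻ Y eq y x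
    ... | inj₂ _ | inj₁ y | inj₁ z = fromDown⁻ Z eq z y
    ... | _ | inj₂ y | inj₂ z = fromDown⁺ X eq y z
    ... | inj₂ x | _ | inj₂ z = fromDown⁺ Y eq z x
    ... | inj₂ x | inj₂ y | _ = fromDown⁺ Z eq x y

-- The central tile and connectedness

centre : Tile
centre = 0ℤ , 0ℤ , true

Region-centre : Region 1ℤ centre
Region-centre = (λ { X → -≤+ , ℤ.≤-refl ; Y → -≤+ , ℤ.≤-refl ; Z → -≤+ , ℤ.≤-refl })
  , λ { (X , x≥1 , _) → 1≤⇒≰0 x≥1 ℤ.≤-refl ; (Y , y≥1 , _) → 1≤⇒≰0 y≥1 ℤ.≤-refl
      ; (Z , z≥1 , _) → 1≤⇒≰0 z≥1 ℤ.≤-refl }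

x+1≤1⇒x≤0 : ∀ {x} → x + 1ℤ ≤ 1ℤ → x ≤ 0ℤ
x+1≤1⇒x≤0 {x} p = certify (gap p) (solve (x ∷ []))

sum≡0⇒0≤ : ∀ {x y z} → x + y + z ≡ 0ℤ → y ≤ 0ℤ → z ≤ 0ℤ → 0ℤ ≤ x
sum≡0⇒0≤ {x} {y} {z} e y≤0 z≤0 = certify (gap y≤0 ⊕ gap z≤0 ⊕ gap₌ (sym e)) (solve (x ∷ y ∷ z ∷ []))

nonpositive⇒centre : ∀ t → up t ≡ true → (∀ a → c a t ≤ 0ℤ) → t ≡ centre
nonpositive⇒centre t@(x , y , true) refl ≤0 = cong₂ (λ x y → x , y , true) (zero-at X) (zero-at Y)
  where
  zero-at : ∀ a → c a t ≡ 0ℤ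
  zero-at a = ℤ.≤-antisym (≤0 a) (sum≡0⇒0≤ (c-sum a t) (≤0 (σ a)) (≤0 (σ (σ a))))

-- All indices are at most 0 here. An up tile is then the centre; a down tile has a negative index,
-- as its sum is -1, and crossing the edge of that axis gives an up tile with all indices at most 0.
Region-1⇒centre : ∀ t → Region 1ℤ t → Path (Region 1ℤ) t centre
Region-1⇒centre t r@(h , _) = byOrientation (up t) refl
  where
  ≤0 : ∀ a → c a t ≤ 0ℤ
  ≤0 a = x+1≤1⇒x≤0 (proj₂ (h a))

  hop : ∀ s → up t ≡ false → c s t + 1ℤ ≤ 0ℤ → Path (Region 1ℤ) t centre
  hop s eq x<0 = subst (Path (Region 1ℤ) t) nb≡
      (Path-nb s r (subst (Region 1ℤ) (sym nb≡) Region-centre))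
    where
    open At (step₁ (at {s} {t} eq refl refl refl))
    ≤0′ : ∀ a → c a (nb s t) ≤ 0ℤ
    ≤0′ a with orbit s a
    ... | inj₁ refl = subst (_≤ 0ℤ) (sym x≡) x<0
    ... | inj₂ (inj₁ refl) = subst (_≤ 0ℤ) (sym y≡) (≤0 (σ s))
    ... | inj₂ (inj₂ refl) = subst (_≤ 0ℤ) (sym z≡) (≤0 (σ (σ s)))
    nb≡ : nb s t ≡ centre
    nb≡ = nonpositive⇒centre (nb s t) up≡ ≤0′

  sum-absurd : ∀ {x y z} → x + y + z ≡ -1ℤ → 0ℤ ≤ x → 0ℤ ≤ y → 0ℤ ≤ z → ⊥
  sum-absurd {x} {y} {z} e p q r = absurd-by (p ⊕ q ⊕ r) e

  byOrientation : ∀ β → up t ≡ β → Path (Region 1ℤ) t centre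
  byOrientation true eq = subst (Path (Region 1ℤ) t) (nonpositive⇒centre t eq ≤0) (here r)
  byOrientation false eq with 0≤⊎<0 (c X t) | 0≤⊎<0 (c Y t) | 0≤⊎<0 (c Z t)
  ... | inj₂ x | _ | _ = hop X eq x
  ... | inj₁ _ | inj₂ y | _ = hop Y eq y
  ... | inj₁ _ | inj₁ _ | inj₂ z = hop Z eq z
  ... | inj₁ x | inj₁ y | inj₁ z = ⊥-elim (sum-absurd (trans (c-sum X t) (cong total eq)) x y z)

Region⇒centre : ∀ n t → Region (+ suc n) t → Path (Region (+ suc n)) t centre
Region⇒centre zero t r = Region-1⇒centre t r
Region⇒centre (suc n) t r = subst (λ κ → Path (Region κ) t centre) eq
  (finish (Inward.inward (+ suc n) (+≤+ (s≤s z≤n)) t (subst (λ κ → Region κ t) (sym eq) r)))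
  where
  eq : + suc n + 1ℤ ≡ + suc (suc n)
  eq = cong +_ (ℕ.+-comm (suc n) 1)
  finish : (∃ λ u → Path (Region (+ suc n + 1ℤ)) t u × Region (+ suc n) u) →
           Path (Region (+ suc n + 1ℤ)) t centre
  finish (u , p , q) = Path-trans p (Path-map Region-widen (Region⇒centre n u q))

-- Parity plays no part: in a ⁺ sector the holes are up tiles and every down tile is solid, in a ⁻
-- sector the orientations are exchanged. The neighbours stay in the sector and do not leave the
-- hexagon.
hole-isolated : ∀ {κ t} → 1ℤ ≤ κ → Hole t → Hex κ t → ∀ a → Region κ (nb a t)
hole-isolated {κ} {t} k≥1 (s , h) hx a = byOrientation (up t) refl h
  where
  pick : (P : Axis → Set) → P s → P (σ s) → P (σ (σ s)) → P a
  pick P p q r with orbit s a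
  ... | inj₁ refl = p
  ... | inj₂ (inj₁ refl) = q
  ... | inj₂ (inj₂ refl) = r

  byOrientation : ∀ β → up t ≡ β → H β (c s t) (c (σ s) t) (c (σ (σ s)) t) → Region κ (nb a t)
  byOrientation true eq (x≥1 , y≤0 , z≤0 , _) = pick (λ a → Region κ (nb a t))
    (hex-down⁺ p₁ k≥1 (gap x≥1) y≤0 z≤0 (ℤ.≤-trans (ℤ.+-monoˡ-≤ 1ℤ (pred≤ (c s t))) x<κ)
      , solid-down⁺ p₁ y≤0 z≤0)
    (hex-down⁺ p₂ k≥1 (1≤⇒0≤ x≥1) (≤0⇒-1≤0 y≤0) z≤0 x<κ , solid-down⁺ p₂ (≤0⇒-1≤0 y≤0) z≤0)
    (hex-down⁺ p₃ k≥1 (1≤⇒0≤ x≥1) y≤0 (≤0⇒-1≤0 z≤0) x<κ , solid-down⁺ p₃ y≤0 (≤0⇒-1≤0 z≤0))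
    where
    x<κ = proj₂ (hx s)
    pred≤ : ∀ x → x - 1ℤ ≤ x
    pred≤ x = certify (0≤+ 1) (solve (x ∷ []))
    p : At s t true (c s t) (c (σ s) t) (c (σ (σ s)) t)
    p = at eq refl refl refl
    p₁ : At s (nb s t) false (c s t - 1ℤ) (c (σ s) t) (c (σ (σ s)) t)
    p₁ = step₁ p
    p₂ : At s (nb (σ s) t) false (c s t) (c (σ s) t - 1ℤ) (c (σ (σ s)) t)
    p₂ = step₂ p
    p₃ : At s (nb (σ (σ s)) t) false (c s t) (c (σ s) t) (c (σ (σ s)) t - 1ℤ)
    p₃ = step₃ p
  byOrientation false eq (x≥1 , z≥1 , _) = pick (λ a → Region κ (nb a t))
    (hex-up⁻ p₁ k≥1 (≤+1 x≥1) z≥1 y≥ , solid-up⁻ p₁ (≤+1 x≥1) z≥1)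
    (hex-up⁻ p₂ k≥1 x≥1 z≥1 (ℤ.≤-trans y≥ (ℤ.i≤i+j _ 1ℤ)) , solid-up⁻ p₂ x≥1 z≥1)
    (hex-up⁻ p₃ k≥1 x≥1 (≤+1 z≥1) y≥ , solid-up⁻ p₃ x≥1 (≤+1 z≥1))
    where
    y≥ = proj₁ (hx (σ s))
    ≤+1 : ∀ {x} → 1ℤ ≤ x → 1ℤ ≤ x + 1ℤ
    ≤+1 p = ℤ.≤-trans p (ℤ.i≤i+j _ 1ℤ)
    p : At s t false (c s t) (c (σ s) t) (c (σ (σ s)) t)
    p = at eq refl refl refl
    p₁ : At s (nb s t) true (c s t + 1ℤ) (c (σ s) t) (c (σ (σ s)) t)
    p₁ = step₁ p
    p₂ : At s (nb (σ s) t) true (c s t) (c (σ s) t + 1ℤ) (c (σ (σ s)) t)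
    p₂ = step₂ p
    p₃ : At s (nb (σ (σ s)) t) true (c s t) (c (σ s) t) (c (σ (σ s)) t + 1ℤ)
    p₃ = step₃ p

-- Enumeration of the holes

third : Bool → ℤ → ℤ → ℤ
third true x y = - (x + y)
third false x y = - (1ℤ + x + y)

-- Inverse of the coordinates seen from `s`: the missing index is recovered from the index sum.
tile : Axis → Bool → ℤ → ℤ → Tile
tile X β x y = x , y , β
tile Y β x y = third β x y , x , β
tile Z β x y = y , third β x y , β

up-tile : ∀ s β x y → up (tile s β x y) ≡ β
up-tile X β x y = refl
up-tile Y β x y = refl
up-tile Z β x y = refl

c-third₁ : ∀ β x y → c Z (third β x y , x , β) ≡ y
c-third₁ true x y = lem x y
  where lem : ∀ x y → - (- (x + y) + x) ≡ y
        lem = solve-∀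
c-third₁ false x y = lem x y
  where lem : ∀ x y → - (1ℤ + - (1ℤ + x + y) + x) ≡ y
        lem = solve-∀

c-third₂ : ∀ β x y → c Z (y , third β x y , β) ≡ x
c-third₂ true x y = lem x y
  where lem : ∀ x y → - (y + - (x + y)) ≡ x
        lem = solve-∀
c-third₂ false x y = lem x y
  where lem : ∀ x y → - (1ℤ + y + - (1ℤ + x + y)) ≡ x
        lem = solve-∀

c-tile : ∀ s β x y → c s (tile s β x y) ≡ x
c-tile X β x y = refl
c-tile Y β x y = refl
c-tile Z β x y = c-third₂ β x y

c-σ-tile : ∀ s β x y → c (σ s) (tile s β x y) ≡ y
c-σ-tile X β x y = refl
c-σ-tile Y β x y = c-third₁ β x y
c-σ-tile Z β x y = refl

tile-unique : ∀ s t → t ≡ tile s (up t) (c s t) (c (σ s) t)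
tile-unique X t = refl
tile-unique Y (x , y , true) = cong (_, y , true) (lem x y)
  where lem : ∀ x y → x ≡ - (y + - (x + y))
        lem = solve-∀
tile-unique Y (x , y , false) = cong (_, y , false) (lem x y)
  where lem : ∀ x y → x ≡ - (1ℤ + y + - (1ℤ + x + y))
        lem = solve-∀
tile-unique Z (x , y , true) = cong (λ y → x , y , true) (lem x y)
  where lem : ∀ x y → y ≡ - (- (x + y) + x)
        lem = solve-∀
tile-unique Z (x , y , false) = cong (λ y → x , y , false) (lem x y)
  where lem : ∀ x y → y ≡ - (1ℤ + - (1ℤ + x + y) + x)
        lem = solve-∀

evenℕ-double : ∀ i → evenℕ (i ℕ.+ i) ≡ true
evenℕ-double zero = refl
evenℕ-double (suc i) rewrite ℕ.+-suc i i = trans (Bool.not-involutive _) (evenℕ-double i)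

evenℕ⇒double : ∀ n → evenℕ n ≡ true → ∃ λ i → n ≡ i ℕ.+ i
evenℕ⇒double zero _ = 0 , refl
evenℕ⇒double (suc (suc n)) ev with evenℕ⇒double n (trans (sym (Bool.not-involutive _)) ev)
... | i , refl = suc i , cong suc (sym (ℕ.+-suc i i))

double-injective : ∀ {i j} → i ℕ.+ i ≡ j ℕ.+ j → i ≡ j
double-injective {zero} {zero} _ = refl
double-injective {suc i} {suc j} eq = cong suc (double-injective
  (ℕ.suc-injective (trans (sym (ℕ.+-suc i i)) (trans (ℕ.suc-injective eq) (ℕ.+-suc j j)))))

-- Within one rotated copy, ring q carries the q holes numbered i < q in cyclic
-- order: first those on its up side, then those on its down side.
data IsHole (s : Axis) (q i : ℕ) (t : Tile) : Set where
  upHole : i ℕ.+ i ℕ.≤ q → up t ≡ true → c s t ≡ + q → c (σ s) t ≡ - (+ (i ℕ.+ i)) → IsHole s q i t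
  downHole : q ℕ.< i ℕ.+ i → up t ≡ false → c s t ≡ + ((q ℕ.∸ i) ℕ.+ (q ℕ.∸ i)) → c (σ s) t ≡ -[1+ q ] →
             IsHole s q i t

-- In one copy, ring q has 2q edges towards ring q - 1. Positions 0 to q are up tiles with y =
-- -position, positions q + 1 to 2q - 1 down tiles with x = 2q - position, and hole i sits at
-- position 2i. As 2q is even, the alternation continues correctly into the next copy.
hole : Axis → ℕ → ℕ → Tile
hole s q i with i ℕ.+ i ℕ.≤? q
... | yes _ = tile s true (+ q) (- (+ (i ℕ.+ i)))
... | no _ = tile s false (+ ((q ℕ.∸ i) ℕ.+ (q ℕ.∸ i))) -[1+ q ]

hole-IsHole : ∀ s q i → IsHole s q i (hole s q i)
hole-IsHole s q i with i ℕ.+ i ℕ.≤? q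
... | yes le = upHole le (up-tile s _ _ _) (c-tile s _ _ _) (c-σ-tile s _ _ _)
... | no gt = downHole (ℕ.≰⇒> gt) (up-tile s _ _ _) (c-tile s _ _ _) (c-σ-tile s _ _ _)

IsHole⇒≡hole : ∀ {s q i t} → IsHole s q i t → t ≡ hole s q i
IsHole⇒≡hole {s} {q} {i} {t} p with i ℕ.+ i ℕ.≤? q | p
... | yes _ | upHole _ u x y = trans (tile-unique s t) (cong₂ (λ f y → f y) (cong₂ (tile s) u x) y)
... | yes le | downHole gt _ _ _ = contradiction le (ℕ.<⇒≱ gt)
... | no gt | upHole le _ _ _ = contradiction le gt
... | no _ | downHole _ u x y = trans (tile-unique s t) (cong₂ (λ f y → f y) (cong₂ (tile s) u x) y)

-- On the holes seen from an axis, this is the number of their ring, the centre being ring 0. Ring q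
-- ends at index q on one side and at -1 - q on the other, since the index window of `Hex` is not
-- symmetric about 0.
radius : Bool → ℤ → ℤ → ℤ
radius true x y = x
radius false x y = -1ℤ - y

ring : Axis → Tile → ℤ
ring s t = radius (up t) (c s t) (c (σ s) t)

IsHole-ring : ∀ {s q i t} → IsHole s q i t → ring s t ≡ + q
IsHole-ring {q = q} (upHole _ u x y) rewrite u = x
IsHole-ring {q = q} (downHole _ u x y) rewrite u | y = refl

IsHole-injective : ∀ {s q i j t} → i ℕ.< q → j ℕ.< q → IsHole s q i t → IsHole s q j t → i ≡ j
IsHole-injective _ _ (upHole _ _ _ y) (upHole _ _ _ y′) =
  double-injective (ℤ.+-injective (⁻¹-injective (trans (sym y) y′)))
IsHole-injective _ _ (upHole _ u _ _) (downHole _ u′ _ _) = contradiction (trans (sym u) u′) λ ()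
IsHole-injective _ _ (downHole _ u _ _) (upHole _ u′ _ _) = contradiction (trans (sym u) u′) λ ()
IsHole-injective i< j< (downHole _ _ x _) (downHole _ _ x′ _) =
  ℕ.∸-cancelˡ-≡ (ℕ.<⇒≤ i<) (ℕ.<⇒≤ j<) (double-injective (ℤ.+-injective (trans (sym x) x′)))

At-HoleAt : ∀ {s t β x y z} → At s t β x y z → H β x y z → HoleAt s t
At-HoleAt (at refl refl refl refl) h = h

IsHole⇒HoleAt : ∀ {s q i t} → i ℕ.< q → IsHole s q i t → HoleAt s t
IsHole⇒HoleAt {s} {q} {i} {t} i<q (upHole le u x y) = At-HoleAt p
  ( +≤+ (ℕ.≤-trans (s≤s z≤n) i<q) , ℤ.neg-mono-≤ (0≤+ (i ℕ.+ i)) , z≤0 (up-sum p)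
  , trans (even-neg (+ (i ℕ.+ i))) (evenℕ-double i))
  where
  p : At s t true (+ q) (- (+ (i ℕ.+ i))) (c (σ (σ s)) t)
  p = at u x y refl
  z≤0 : ∀ {z} → + q + - (+ (i ℕ.+ i)) + z ≡ 0ℤ → z ≤ 0ℤ
  z≤0 {z} e = certify (gap (+≤+ le) ⊕ gap₌ e) (lem (+ q) (+ (i ℕ.+ i)) z)
    where lem : ∀ q m z → 0ℤ - z ≡ q - m + (0ℤ - (q + - m + z))
          lem = solve-∀
IsHole⇒HoleAt {s} {q} {i} {t} i<q (downHole gt u x y) = At-HoleAt p
  ( +≤+ (ℕ.≤-trans (ℕ.m<n⇒0<n∸m i<q) (ℕ.m≤m+n _ _)) , z≥1 (down-sum p) , evenℕ-double (q ℕ.∸ i))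
  where
  m = (q ℕ.∸ i) ℕ.+ (q ℕ.∸ i)
  p : At s t false (+ m) -[1+ q ] (c (σ (σ s)) t)
  p = at u x y refl
  -- Adding 2i turns this into 2q < 2i + q.
  m<q : m ℕ.< q
  m<q = ℕ.+-cancelˡ-< (i ℕ.+ i) m q (subst (ℕ._< i ℕ.+ i ℕ.+ q) (sym (eq i (q ℕ.∸ i)))
    (subst (λ v → v ℕ.+ v ℕ.< i ℕ.+ i ℕ.+ q) (sym (ℕ.m+[n∸m]≡n (ℕ.<⇒≤ i<q))) (ℕ.+-monoˡ-< q gt)))
    where eq : ∀ i r → i ℕ.+ i ℕ.+ (r ℕ.+ r) ≡ (i ℕ.+ r) ℕ.+ (i ℕ.+ r)
          eq = solveℕ-∀
  z≥1 : ∀ {z} → + m + -[1+ q ] + z ≡ -1ℤ → 1ℤ ≤ z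
  z≥1 {z} e = certify (gap (+≤+ m<q) ⊕ gap₌ (sym e)) (lem (+ q) (+ m) z)
    where lem : ∀ q m z → z - 1ℤ ≡ q - (1ℤ + m) + (m + - (1ℤ + q) + z - -1ℤ)
          lem = solve-∀

HoleAt⇒IsHole : ∀ s t → HoleAt s t → ∃ λ q → ∃ λ i → i ℕ.< q × IsHole s q i t
HoleAt⇒IsHole s t h = byOrientation (up t) refl h
  where
  nonneg : ∀ {x} → 0ℤ ≤ x → x ≡ + ∣ x ∣
  nonneg p = sym (ℤ.0≤i⇒+∣i∣≡i p)

  half< : ∀ {q} i → 1 ℕ.≤ q → i ℕ.+ i ℕ.≤ q → i ℕ.< q
  half< zero q≥1 _ = q≥1
  half< (suc i) _ le = ℕ.<-≤-trans (ℕ.m<m+n (suc i) (s≤s z≤n)) le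

  fromUp : ∀ {x y z} → At s t true x y z → H true x y z → ∃ λ q → ∃ λ i → i ℕ.< q × IsHole s q i t
  fromUp {x} {y} {z} p (x≥1 , y≤0 , z≤0 , ev) with evenℕ⇒double ∣ y ∣ ev
  ... | i , ∣y∣≡ = ∣ x ∣ , i , half< i (ℤ.drop‿+≤+ (subst (1ℤ ≤_) x≡ x≥1)) le
        , upHole le (At.up≡ p) (trans (At.x≡ p) x≡) (trans (At.y≡ p) y≡)
    where
    x≡ : x ≡ + ∣ x ∣
    x≡ = nonneg (1≤⇒0≤ x≥1)
    y≡ : y ≡ - (+ (i ℕ.+ i))
    y≡ = trans (sym (ℤ.neg-involutive y)) (cong -_ (trans (nonneg (ℤ.neg-mono-≤ y≤0))
           (cong +_ (trans (ℤ.∣-i∣≡∣i∣ y) ∣y∣≡))))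
    sum≤ : ∀ {x m z} → x + - m + z ≡ 0ℤ → z ≤ 0ℤ → m ≤ x
    sum≤ {x} {m} {z} e z≤0 = certify (gap z≤0 ⊕ gap₌ (sym e)) (solve (x ∷ m ∷ z ∷ []))
    le : i ℕ.+ i ℕ.≤ ∣ x ∣
    le = ℤ.drop‿+≤+ (sum≤ (trans (cong₂ (λ x y → x + y + z) (sym x≡) (sym y≡)) (up-sum p)) z≤0)

  fromDown : ∀ {x y z} → At s t false x y z → H false x y z → ∃ λ q → ∃ λ i → i ℕ.< q × IsHole s q i t
  fromDown {x} {y} {z} p (x≥1 , z≥1 , ev) with evenℕ⇒double ∣ x ∣ ev
  -- With x = 2i and z = n the index sum gives y = -1 - (2i + n). So the ring is q = 2i + n, and the
  -- number of the hole is q - i = i + n.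
  ... | i , ∣x∣≡ = i ℕ.+ (i ℕ.+ n) , i ℕ.+ n , ℕ.m<n+m (i ℕ.+ n) i≥1
        , downHole lt (At.up≡ p) (trans (At.x≡ p) (trans x≡ (cong +_ (trans ∣x∣≡ (sym (cong₂ ℕ._+_ q∸ q∸))))))
            (trans (At.y≡ p) y≡)
    where
    n = ∣ z ∣
    x≡ : x ≡ + ∣ x ∣
    x≡ = nonneg (1≤⇒0≤ x≥1)
    z≡ : z ≡ + n
    z≡ = nonneg (1≤⇒0≤ z≥1)
    n≥1 : 1 ℕ.≤ n
    n≥1 = ℤ.drop‿+≤+ (subst (1ℤ ≤_) z≡ z≥1)
    i≥1 : 1 ℕ.≤ i
    i≥1 = ℕ.n≢0⇒n>0 λ { refl → ℕ.<⇒≱ (ℤ.drop‿+≤+ (subst (1ℤ ≤_) x≡ x≥1)) (ℕ.≤-reflexive ∣x∣≡) }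
    q∸ : i ℕ.+ (i ℕ.+ n) ℕ.∸ (i ℕ.+ n) ≡ i
    q∸ = ℕ.m+n∸n≡m i (i ℕ.+ n)
    lt : i ℕ.+ (i ℕ.+ n) ℕ.< i ℕ.+ n ℕ.+ (i ℕ.+ n)
    lt = ℕ.+-monoˡ-< (i ℕ.+ n) (ℕ.m<m+n i n≥1)
    y≡ : y ≡ -[1+ i ℕ.+ (i ℕ.+ n) ]
    y≡ = trans (lem x y z) (trans (cong (λ e → e - x - z) (down-sum p))
      (trans (cong₂ (λ x z → -1ℤ - x - z) (trans x≡ (cong +_ ∣x∣≡)) z≡) (lem₂ (+ i) (+ n))))
      where
      lem : ∀ x y z → y ≡ x + y + z - x - z
      lem = solve-∀
      lem₂ : ∀ i n → -1ℤ - (i + i) - n ≡ - (1ℤ + (i + (i + n)))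
      lem₂ = solve-∀

  byOrientation : ∀ β → up t ≡ β → H β (c s t) (c (σ s) t) (c (σ (σ s)) t) →
                  ∃ λ q → ∃ λ i → i ℕ.< q × IsHole s q i t
  byOrientation true eq h = fromUp (at eq refl refl refl) h
  byOrientation false eq h = fromDown (at eq refl refl refl) h

-- Together with `Hex-ring`: whether a hole lies in a hexagon depends only on its ring.
HoleAt-Hex : ∀ {κ s t} → 1ℤ ≤ κ → HoleAt s t → ring s t + 1ℤ ≤ κ → Hex κ t
HoleAt-Hex {κ} {s} {t} k≥1 = byOrientation (up t) refl
  where
  byOrientation : ∀ β → up t ≡ β → H β (c s t) (c (σ s) t) (c (σ (σ s)) t) →
                  radius β (c s t) (c (σ s) t) + 1ℤ ≤ κ → Hex κ t
  byOrientation true eq (x≥1 , y≤0 , z≤0 , _) lt =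
    hex-up⁺ (at {s} {t} eq refl refl refl) k≥1 x≥1 y≤0 z≤0 lt
  byOrientation false eq (x≥1 , z≥1 , _) lt =
    hex-down⁻ (at {s} {t} eq refl refl refl) k≥1 (1≤⇒0≤ x≥1) (1≤⇒0≤ z≥1) (lower lt)
    where
    lower : ∀ {y} → -1ℤ - y + 1ℤ ≤ κ → - κ ≤ y
    lower {y} p = certify (gap p) (solve (y ∷ κ ∷ []))

Hex-ring : ∀ {κ s t} → Hex κ t → ring s t + 1ℤ ≤ κ
Hex-ring {κ} {s} {t} hx = go (up t)
  where
  upper : ∀ {y} → - κ ≤ y → -1ℤ - y + 1ℤ ≤ κ
  upper {y} p = certify (gap p) (solve (y ∷ κ ∷ []))
  go : ∀ β → radius β (c s t) (c (σ s) t) + 1ℤ ≤ κ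
  go true = proj₂ (hx s)
  go false = upper (proj₁ (hx (σ s)))

-- Of any two different axes one is `σ` of the other, so this makes all three copies disjoint.
HoleAt-σ : ∀ s t → HoleAt s t → ¬ HoleAt (σ s) t
HoleAt-σ s t h h′ = go (up t) refl h (At⇒H (rotate (here-at s t)) h′)
  where
  sum-absurd : ∀ {x y z} → x + y + z ≡ -1ℤ → 1ℤ ≤ x → 1ℤ ≤ y → 1ℤ ≤ z → ⊥
  sum-absurd {x} {y} {z} e p q r = absurd-by (1≤⇒0≤ p ⊕ 1≤⇒0≤ q ⊕ 1≤⇒0≤ r) e
  go : ∀ β → up t ≡ β → H β (c s t) (c (σ s) t) (c (σ (σ s)) t) →
       H β (c (σ s) t) (c (σ (σ s)) t) (c s t) → ⊥
  go true eq (x≥1 , _) (_ , _ , x≤0 , _) = 1≤⇒≰0 x≥1 x≤0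
  go false eq (x≥1 , z≥1 , _) (y≥1 , _) =
    sum-absurd (down-sum (at {s} {t} eq refl refl refl)) x≥1 y≥1 z≥1

holesAlong : Axis → ℕ → List Tile
holesAlong s zero = []
holesAlong s (suc q) = applyUpTo (hole s q) q ++ holesAlong s q

∈-holesAlong⁻ : ∀ s k {t} → t ∈ holesAlong s k → ∃ λ q → ∃ λ i → q ℕ.< k × i ℕ.< q × IsHole s q i t
∈-holesAlong⁻ s (suc q) p with ∈-++⁻ (applyUpTo (hole s q) q) p
... | inj₁ p₁ with ∈-applyUpTo⁻ (hole s q) p₁
... | i , i< , refl = q , i , ℕ.≤-refl , i< , hole-IsHole s q i
∈-holesAlong⁻ s (suc q) p | inj₂ p₂ with ∈-holesAlong⁻ s q p₂
... | q′ , i , q< , i< , h = q′ , i , ℕ.m≤n⇒m≤1+n q< , i< , h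

∈-holesAlong⁺ : ∀ s k {q i} → q ℕ.< k → i ℕ.< q → hole s q i ∈ holesAlong s k
∈-holesAlong⁺ s (suc k) {q} q<k i<q with q ℕ.≟ k
... | yes refl = ∈-++⁺ˡ (∈-applyUpTo⁺ (hole s q) i<q)
... | no q≢k = ∈-++⁺ʳ (applyUpTo (hole s k) k) (∈-holesAlong⁺ s k (ℕ.≤∧≢⇒< (ℕ.s≤s⁻¹ q<k) q≢k) i<q)

length-holesAlong : ∀ s k → length (holesAlong s k) ≡ triangular k
length-holesAlong s zero = refl
length-holesAlong s (suc q) = trans (length-++ (applyUpTo (hole s q) q))
  (cong₂ ℕ._+_ (length-applyUpTo (hole s q) q) (length-holesAlong s q))

holesAlong-unique : ∀ s k → Unique (holesAlong s k)
holesAlong-unique s zero = AllPairs.[]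
holesAlong-unique s (suc q) = Unique.++⁺
  (Unique.applyUpTo⁺₁ (hole s q) q λ {i} {j} i<j j<q eq → ℕ.<⇒≢ i<j
    (IsHole-injective (ℕ.<-trans i<j j<q) j<q (hole-IsHole s q i) (subst (IsHole s q j) (sym eq) (hole-IsHole s q j))))
  (holesAlong-unique s q)
  λ (p₁ , p₂) → disjoint (∈-applyUpTo⁻ (hole s q) p₁) (∈-holesAlong⁻ s q p₂)
  where
  disjoint : ∀ {t} → (∃ λ i → i ℕ.< q × t ≡ hole s q i) →
             (∃ λ q′ → ∃ λ i → q′ ℕ.< q × i ℕ.< q′ × IsHole s q′ i t) → ⊥
  disjoint (i , _ , refl) (q′ , _ , q′<q , _ , h) =
    ℕ.<⇒≢ q′<q (ℤ.+-injective (trans (sym (IsHole-ring h)) (IsHole-ring (hole-IsHole s q i))))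

∈-holesAlong⇒HoleAt : ∀ s k {t} → t ∈ holesAlong s k → HoleAt s t
∈-holesAlong⇒HoleAt s k p = let (_ , _ , _ , i<q , h) = ∈-holesAlong⁻ s k p in IsHole⇒HoleAt i<q h

holes : ℕ → List Tile
holes k = holesAlong X k ++ holesAlong Y k ++ holesAlong Z k

holes-unique : ∀ k → Unique (holes k)
holes-unique k = Unique.++⁺ (holesAlong-unique X k)
  (Unique.++⁺ (holesAlong-unique Y k) (holesAlong-unique Z k)
    λ {t} (p , q) → HoleAt-σ Y t (∈-holesAlong⇒HoleAt Y k p) (∈-holesAlong⇒HoleAt Z k q))
  λ {t} (p , q) → Sum.[ (λ r → HoleAt-σ X t (∈-holesAlong⇒HoleAt X k p) (∈-holesAlong⇒HoleAt Y k r))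
                  , (λ r → HoleAt-σ Z t (∈-holesAlong⇒HoleAt Z k r) (∈-holesAlong⇒HoleAt X k p)) ]
                  (∈-++⁻ (holesAlong Y k) q)

length-holes : ∀ k → length (holes k) ≡ 3 ℕ.* triangular k
length-holes k = trans (length-++ (holesAlong X k)) (cong₂ ℕ._+_ (length-holesAlong X k)
  (trans (length-++ (holesAlong Y k)) (cong₂ ℕ._+_ (length-holesAlong Y k)
    (trans (length-holesAlong Z k) (sym (ℕ.+-identityʳ _))))))

∈-holes⁻ : ∀ k {t} → 1 ℕ.≤ k → t ∈ holes k → Hole t × Hex (+ k) t
∈-holes⁻ k {t} k≥1 = Sum.[ along X , Sum.[ along Y , along Z ] ∘ ∈-++⁻ (holesAlong Y k) ] ∘ ∈-++⁻ (holesAlong X k)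
  where
  along : ∀ s → t ∈ holesAlong s k → Hole t × Hex (+ k) t
  along s p =
    let (q , i , q<k , i<q , h) = ∈-holesAlong⁻ s k p
        ha = IsHole⇒HoleAt i<q h
    in (s , ha) , HoleAt-Hex {s = s} (+≤+ k≥1) ha
      (subst (λ r → r + 1ℤ ≤ + k) (sym (IsHole-ring h)) (+≤+ (subst (ℕ._≤ k) (ℕ.+-comm 1 q) q<k)))

∈-holes⁺ : ∀ {k t} → Hole t → Hex (+ k) t → t ∈ holes k
∈-holes⁺ {k} {t} (s , ha) hx with HoleAt⇒IsHole s t ha
... | q , i , i<q , h = embed s (subst (_∈ holesAlong s k) (sym (IsHole⇒≡hole h)) (∈-holesAlong⁺ s k q<k i<q))
  where
  q<k : q ℕ.< k
  q<k = subst (ℕ._≤ k) (ℕ.+-comm q 1) (ℤ.drop‿+≤+ (subst (λ r → r + 1ℤ ≤ + k) (IsHole-ring h) (Hex-ring {s = s} hx)))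
  embed : ∀ s → t ∈ holesAlong s k → t ∈ holes k
  embed X p = ∈-++⁺ˡ p
  embed Y p = ∈-++⁺ʳ (holesAlong X k) (∈-++⁺ˡ p)
  embed Z p = ∈-++⁺ʳ (holesAlong X k) (∈-++⁺ʳ (holesAlong Y k) p)

Unique⇒lookup-injective : ∀ {A : Set} {xs : List A} → Unique xs → ∀ {i j} →
                          lookup xs i ≡ lookup xs j → i ≡ j
Unique⇒lookup-injective (_ AllPairs.∷ _) {Fin.zero} {Fin.zero} _ = refl
Unique⇒lookup-injective (x∉ AllPairs.∷ _) {Fin.zero} {Fin.suc j} eq = contradiction eq (All.lookup x∉ (∈-lookup j))
Unique⇒lookup-injective (x∉ AllPairs.∷ _) {Fin.suc i} {Fin.zero} eq = contradiction (sym eq) (All.lookup x∉ (∈-lookup i))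
Unique⇒lookup-injective (_ AllPairs.∷ u) {Fin.suc i} {Fin.suc j} eq = cong Fin.suc (Unique⇒lookup-injective u eq)

-- The extremal polyiamond and its holes

module Construction (m : ℕ) where
  k : ℕ
  k = suc m

  open Box (- (+ k)) (- (+ k)) (k ℕ.+ k) (k ℕ.+ k)

  polyiamond : List Tile
  polyiamond = filter (Region? (+ k)) parallelogram

  Hex⇒InBox : ∀ {t} → Hex (+ k) t → InBox t
  Hex⇒InBox {t} h = inBox (proj₁ (h X)) (below (h X)) (proj₁ (h Y)) (below (h Y))
    where
    below : ∀ {x} → Within (+ k) x → x + 1ℤ ≤ - (+ k) + + (k ℕ.+ k)
    below {x} (_ , le) = subst (x + 1ℤ ≤_) (lem (+ k)) le
      where lem : ∀ k → k ≡ - k + (k + k)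
            lem = solve-∀

  ∈-polyiamond⁺ : ∀ {t} → Region (+ k) t → t ∈ polyiamond
  ∈-polyiamond⁺ r = ∈-filter⁺ (Region? (+ k)) (InBox⇒∈ (Hex⇒InBox (proj₁ r))) r

  ∈-polyiamond⁻ : ∀ {t} → t ∈ polyiamond → Region (+ k) t
  ∈-polyiamond⁻ p = proj₂ (∈-filter⁻ (Region? (+ k)) {xs = parallelogram} p)

  k≥1 : 1ℤ ≤ + k
  k≥1 = +≤+ (s≤s z≤n)

  toCentre : ∀ {t} → t ∈ polyiamond → Path (_∈ polyiamond) t centre
  toCentre {t} p = Path-map ∈-polyiamond⁺ (Region⇒centre m t (∈-polyiamond⁻ p))

  Region-centreₖ : ∀ n → Region (+ suc n) centre
  Region-centreₖ zero = Region-centre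
  Region-centreₖ (suc n) = subst (λ κ → Region (+ κ) centre) (ℕ.+-comm (suc n) 1) (Region-widen (Region-centreₖ n))

  isPolyiamond : IsPolyiamond polyiamond
  isPolyiamond = Unique.filter⁺ (Region? (+ k)) parallelogram-unique
    , nonempty (∈-polyiamond⁺ (Region-centreₖ m))
    , λ t u t∈ u∈ → Path-trans (toCentre t∈) (Path-sym (toCentre u∈))
    where
    nonempty : ∀ {xs : List Tile} {x} → x ∈ xs → ¬ xs ≡ []
    nonempty p refl with () ← p

  hole-∉ : ∀ {t} → t ∈ holes k → t ∉ polyiamond
  hole-∉ p q = proj₂ (∈-polyiamond⁻ q) (proj₁ (∈-holes⁻ k (s≤s z≤n) p))

  hole-component : ∀ {t u} → t ∈ holes k → Path (Out polyiamond) t u → u ≡ t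
  hole-component _ (here _) = refl
  hole-component {t} p (step _ adj q) with Adj⇒nb adj
  ... | a , refl = contradiction
    (∈-polyiamond⁺ (hole-isolated k≥1 (proj₁ (∈-holes⁻ k (s≤s z≤n) p)) (proj₂ (∈-holes⁻ k (s≤s z≤n) p)) a))
    (Path-start q)

  -- One of the strips of `t` misses the hexagon. Walking along it keeps the offending index, so the
  -- walk escapes.
  outside-unbounded : ∀ {t} → ¬ Hex (+ k) t → ¬ BoundedComp polyiamond t
  outside-unbounded {t} ¬hex bounded = ¬hex λ a → within a (- (+ k) ℤ.≤? c a t ×-dec c a t + 1ℤ ℤ.≤? + k)
    where
    within : ∀ a → Dec (Within (+ k) (c a t)) → Within (+ k) (c a t)
    within a (yes w) = w
    within a (no ¬w) = ⊥-elim (Escapes⇒unbounded polyiamond {d = a , true}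
      (λ n p → ¬w (subst (Within (+ k)) (c-iter a true n t) (proj₁ (∈-polyiamond⁻ p) a))) bounded)

  hasHoles : HasHoles polyiamond (length (holes k))
  hasHoles = lookup (holes k)
    , (λ i → hole-∉ (∈-lookup i) , lookup (holes k) i ∷ [] , λ u p → here (hole-component (∈-lookup i) p))
    , (λ i j p → Unique⇒lookup-injective (holes-unique k) (sym (hole-component (∈-lookup i) p)))
    , λ t t∉ bounded → complete t∉ bounded (Hex? (+ k) t) (Hole? t)
    where
    complete : ∀ {t} → t ∉ polyiamond → BoundedComp polyiamond t → Dec (Hex (+ k) t) → Dec (Hole t) →
               ∃ λ i → Path (Out polyiamond) t (lookup (holes k) i)
    complete t∉ bounded (no ¬hex) _ = contradiction bounded (outside-unbounded ¬hex)
    complete t∉ bounded (yes hex) (no ¬o) = contradiction (∈-polyiamond⁺ (hex , ¬o)) t∉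
    complete t∉ bounded (yes hex) (yes o) =
      let p = ∈-holes⁺ o hex in index p , subst (Path (Out polyiamond) _) (Any.lookup-index p) (here t∉)

  -- Tiles and holes together fit into the 2k by 2k parallelogram without corner triangles of sides
  -- k + 1 and k - 1, that is 8k² - (k + 1)² - (k - 1)² = 6k² - 2 tiles. Subtracting the 3T holes
  -- leaves n_k.
  size-bound : length polyiamond ℕ.≤ nk k
  size-bound = subst (length polyiamond ℕ.≤_) (sym (nk≡ k)) (ℕ.m+n≤o⇒m≤o∸n (length polyiamond)
    (ℕ.+-cancelʳ-≤ (3 ℕ.* T ℕ.+ 2 ℕ.* (k ℕ.* k)) (length polyiamond ℕ.+ 2) (9 ℕ.* T ℕ.+ 6 ℕ.* k) (finish (hexagon-count (polyiamond ++ holes k) unique (λ p → Hex⇒InBox (inHex p)) Z≤ Z≥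
      (s≤s (ℕ.m≤n+m (suc m) m)) (s≤s (ℕ.m≤n+m (suc m) m)) (ℕ.m≤n⇒m≤1+n (ℕ.m≤m+n m (suc m))) (ℕ.m≤n⇒m≤1+n (ℕ.m≤m+n m (suc m)))))))
    where
    T = triangular k
    unique : Unique (polyiamond ++ holes k)
    unique = Unique.++⁺ (proj₁ isPolyiamond) (holes-unique k) λ (p , q) → hole-∉ q p
    inHex : ∀ {t} → t ∈ polyiamond ++ holes k → Hex (+ k) t
    inHex {t} p = Sum.[_,_] {C = λ _ → Hex (+ k) t}
      (λ q → proj₁ (∈-polyiamond⁻ q)) (λ q → proj₂ (∈-holes⁻ k (s≤s z≤n) q)) (∈-++⁻ polyiamond p)
    Z≤ : ∀ {t} → t ∈ polyiamond ++ holes k → c Z t ≤ - (- (+ k) + - (+ k) + + suc k)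
    Z≤ {t} p = certify (gap (proj₂ (inHex p Z))) (lem (c Z t) (+ k))
      where lem : ∀ z k → - (- k + - k + (1ℤ + k)) - z ≡ k - (z + 1ℤ)
            lem = solve-∀
    Z≥ : ∀ {t} → t ∈ polyiamond ++ holes k →
         1ℤ - - (+ k) - - (+ k) - + (k ℕ.+ k) - + (k ℕ.+ k) + + m ≤ c Z t
    Z≥ {t} p = certify (gap (proj₁ (inHex p Z))) (lem (c Z t) (+ m))
      where lem : ∀ z m → z - (1ℤ - - (1ℤ + m) - - (1ℤ + m) - (1ℤ + m + (1ℤ + m)) - (1ℤ + m + (1ℤ + m)) + m) ≡ z - - (1ℤ + m)
            lem = solve-∀
    finish : length (polyiamond ++ holes k) ℕ.+ (suc k ℕ.* suc k ℕ.+ m ℕ.* m) ℕ.≤ (k ℕ.+ k) ℕ.* ((k ℕ.+ k) ℕ.* 2) →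
             length polyiamond ℕ.+ 2 ℕ.+ (3 ℕ.* T ℕ.+ 2 ℕ.* (k ℕ.* k)) ℕ.≤ 9 ℕ.* T ℕ.+ 6 ℕ.* k ℕ.+ (3 ℕ.* T ℕ.+ 2 ℕ.* (k ℕ.* k))
    finish = subst₂ ℕ._≤_
      (trans (cong (ℕ._+ (suc k ℕ.* suc k ℕ.+ m ℕ.* m)) (trans (length-++ polyiamond) (cong (length polyiamond ℕ.+_) (length-holes k))))
        (lem₁ (length polyiamond) T m))
      (trans (lem₂ k) (trans (cong (λ e → 6 ℕ.* e ℕ.+ 2 ℕ.* (k ℕ.* k)) (sym (2*triangular k))) (lem₃ T k)))
      where
      lem₁ : ∀ n t m → n ℕ.+ 3 ℕ.* t ℕ.+ (suc (suc m) ℕ.* suc (suc m) ℕ.+ m ℕ.* m) ≡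
                       n ℕ.+ 2 ℕ.+ (3 ℕ.* t ℕ.+ 2 ℕ.* (suc m ℕ.* suc m))
      lem₁ = solveℕ-∀
      lem₂ : ∀ k → (k ℕ.+ k) ℕ.* ((k ℕ.+ k) ℕ.* 2) ≡ 6 ℕ.* (k ℕ.* k) ℕ.+ 2 ℕ.* (k ℕ.* k)
      lem₂ = solveℕ-∀
      lem₃ : ∀ t k → 6 ℕ.* (2 ℕ.* t ℕ.+ k) ℕ.+ 2 ℕ.* (k ℕ.* k) ≡
                     9 ℕ.* t ℕ.+ 6 ℕ.* k ℕ.+ (3 ℕ.* t ℕ.+ 2 ℕ.* (k ℕ.* k))
      lem₃ = solveℕ-∀

theorem1 : ∀ (k : ℕ) → 2 ℕ.≤ k → gTriEq (hk k) (nk k)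
theorem1 k@(suc m) k≥2 =
  -- The construction is only bounded from above; the lower bound, applied to it, gives the exact
  -- size.
  (polyiamond , isPolyiamond , withHoles , ℕ.≤-antisym size-bound (lower-bound k k≥2 polyiamond isPolyiamond withHoles))
  , lower-bound k k≥2
  where
  open Construction m using (polyiamond; isPolyiamond; hasHoles; size-bound)
  withHoles : HasHoles polyiamond (hk k)
  withHoles = subst (HasHoles polyiamond) (trans (length-holes k) (sym (hk≡ k))) hasHoles
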